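{- Let $n \ge 3$ be an integer and let $G = P_n \Box P_3$. Then $$S_{SC}(G) = [1,3n-3] \setminus \{2,3,5,7\},$$ where $[1,3n-3]$ denotes the set of integers $r$ with $1\le r\le 3n-3$.
   Context: $P_n$ denotes the path on $n$ vertices and $G\Box H$ the cartesian product of graphs. An orientation $D$ of a graph is strong if for every ordered pair of vertices $u,v$ there is a directed path from $u$ to $v$. A $uv$-geodesic in $D$ is a shortest directed path from $u$ to $v$. A nonempty set $S\subseteq V(D)$ is convex in $D$ if for every $u,v\in S$, every vertex lying on a $uv$-geodesic or on a $vu$-geodesic belongs to $S$. The convexity number $\mathrm{con}(D)$ is the maximum cardinality of a convex set of $D$ different from $V(D)$. The strong convexity spectrum of a graph $G$ is $S_{SC}(G)=\{\mathrm{con}(D) : D \text{ is a strong orientation of } G\}$. -}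

module Defs where

open import Data.Fin.Base using (Fin; toℕ; quotient; remainder)
open import Data.Fin.Subset using (Subset; ⊤; _∈_; Nonempty; ∣_∣)
open import Data.List.Base using (List; []; _∷_)
import Data.List.Membership.Propositional as List
open import Data.List.Relation.Unary.Unique.Propositional using (Unique)
open import Data.Nat.Base using (ℕ; zero; suc; _*_; _≤_)
open import Data.Nat.Properties using (1+n≢n)
open import Data.Product.Base using (Σ; ∃; _×_; _,_)
import Data.Product.Base as Product
open import Data.Sum.Base using (_⊎_; inj₁; inj₂; swap; [_,_])
import Data.Sum.Base as Sum
open import Level using (0ℓ)
open import Relation.Binary.Construct.Closure.ReflexiveTransitive using (Star; ε; _◅_)
open import Relation.Binary.Core using (Rel)
open import Relation.Binary.Definitions using (Symmetric; Asymmetric)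
open import Relation.Binary.PropositionalEquality using (_≡_; _≢_; sym)
open import Relation.Nullary.Negation using (¬_)
open import Relation.Unary using (Pred)

private
  variable
    m n : ℕ

record Graph (n : ℕ) : Set₁ where
  field
    Adj        : Rel (Fin n) 0ℓ
    adj-sym    : Symmetric Adj
    adj-irrefl : ∀ v → ¬ Adj v v

P : ∀ n → Graph n
P n = record
  { Adj        = λ i j → suc (toℕ i) ≡ toℕ j ⊎ suc (toℕ j) ≡ toℕ i
  ; adj-sym    = swap
  ; adj-irrefl = λ _ → [ 1+n≢n , 1+n≢n ]
  }

-- The vertex (a , b) of the product is encoded as combine a b : Fin (m * n),
-- whose components are recovered by quotient and remainder.
infixl 7 _□_
_□_ : Graph m → Graph n → Graph (m * n)
_□_ {m} {n} G H = record
  { Adj        = λ x y → (fst x ≡ fst y × H.Adj (snd x) (snd y))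
                       ⊎ (G.Adj (fst x) (fst y) × snd x ≡ snd y)
  ; adj-sym    = Sum.map (Product.map sym H.adj-sym) (Product.map G.adj-sym sym)
  ; adj-irrefl = λ _ → [ (λ (_ , b) → H.adj-irrefl _ b) , (λ (a , _) → G.adj-irrefl _ a) ]
  }
  where
  module G = Graph G
  module H = Graph H

  fst : Fin (m * n) → Fin m
  fst = quotient {m} n

  snd : Fin (m * n) → Fin n
  snd = remainder {m} n

record Orientation (G : Graph n) : Set₁ where
  open Graph G
  field
    Arc      : Rel (Fin n) 0ℓ
    arc⇒adj  : ∀ {u v} → Arc u v → Adj u v
    adj⇒arc  : ∀ {u v} → Adj u v → Arc u v ⊎ Arc v u
    arc-asym : Asymmetric Arc

module _ {G : Graph n} (D : Orientation G) where
  open Orientation D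

  vertices : ∀ {u v} → Star Arc u v → List (Fin n)
  vertices {u} ε       = u ∷ []
  vertices {u} (_ ◅ w) = u ∷ vertices w

  walkLength : ∀ {u v} → Star Arc u v → ℕ
  walkLength ε       = zero
  walkLength (_ ◅ w) = suc (walkLength w)

  record DirectedPath (u v : Fin n) : Set where
    field
      walk   : Star Arc u v
      simple : Unique (vertices walk)

  open DirectedPath

  Strong : Set
  Strong = ∀ u v → DirectedPath u v

  IsGeodesic : ∀ {u v} → DirectedPath u v → Set
  IsGeodesic {u} {v} p = (q : DirectedPath u v) → walkLength (walk p) ≤ walkLength (walk q)

  OnGeodesic : (u v w : Fin n) → Set
  OnGeodesic u v w = Σ (DirectedPath u v) λ p → IsGeodesic p × w List.∈ vertices (walk p)

  Convex : Subset n → Set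
  Convex S = Nonempty S ×
    (∀ {u v} → u ∈ S → v ∈ S → ∀ {w} → OnGeodesic u v w ⊎ OnGeodesic v u w → w ∈ S)

  -- Relational: k is the convexity number of D, the maximum of ∣ S ∣ over the
  -- convex sets S other than the whole vertex set.
  IsConvexityNumber : ℕ → Set
  IsConvexityNumber k =
      (∃ λ S → Convex S × S ≢ ⊤ × ∣ S ∣ ≡ k)
    × (∀ S → Convex S → S ≢ ⊤ → ∣ S ∣ ≤ k)

StrongConvexitySpectrum : Graph n → Pred ℕ _
StrongConvexitySpectrum G r = Σ (Orientation G) λ D → Strong D × IsConvexityNumber D r

{-# OPTIONS --safe #-}

-- Necessity.  In a convex set with at least two elements every vertex has an in-neighbour and an
-- out-neighbour, hence two neighbours, within the set.  Looking at its first two and its last two columns, such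
-- a set has 4, 6, 7 or at least 8 vertices, and 7 only when it consists of two squares that meet in the centre
-- of a 3 × 3 block.  In that case filling all columns to the right of the centre gives a larger proper convex
-- set, because no boundary vertex is added.  At most two missing vertices are impossible, because some directed
-- path of length two or three through them is a geodesic: the grid is bipartite.
--
-- Sufficiency.  Turn every unit square into a directed cycle, adjacent squares turning in opposite directions.
-- The way back along an arc of a directed square has length three and is a geodesic, so every arc generates all
-- vertices.  Small orientations that deviate from this pattern only in the middle realise 1, 4, 6, 8 and 10.
-- Prepending a column that continues the pattern keeps the old grid isometric, as folding the new column onto
-- the second old one shows.  At the end where the largest convex set lies this adds 3 to the convexity number,
-- at the other end it leaves the number unchanged.
module Submission where

open import Defs
open import Data.Bool.Base using (Bool; true; false; not; _∧_; _∨_; T; if_then_else_)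
open import Data.Bool.ListAction using (any; all)
open import Data.Bool.Properties using (T-∧; T-∨; T-≡; not-involutive; not-¬)
open import Data.Fin.Base using (Fin; zero; suc; toℕ; opposite; inject₁; fromℕ; quotient; remainder; _↑ˡ_)
open import Data.Fin.Patterns
import Data.Fin.Permutation as Permutation
import Data.Fin.Properties as Fin
open import Data.Fin.Properties using (opposite-involutive)
open import Data.Fin.Subset using (Subset; ⊤; ⊥; ∁; ⁅_⁆; _-_; _∈_; _∉_; _⊆_; Nonempty; ∣_∣)
open import Data.Fin.Subset.Properties
  using ( _∈?_; ∈⊤; ⊆-antisym; nonempty?; Empty-unique; p⊆q⇒∣p∣≤∣q∣; p⊂q⇒∣p∣<∣q∣; ∣p∣≤n; ∣⊥∣≡0; ∣p∣≡n⇒p≡⊤; ∣∁p∣≡n∸∣p∣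
        ; x∈⁅x⁆; ∣⁅x⁆∣≡1; x∉p⇒x∈∁p; x∈p∧x≢y⇒x∈p-y; x∈p⇒∣p-x∣<∣p∣)
open import Data.List.Base as List using (List; []; _∷_)
import Data.List.Membership.DecPropositional as ListDec
import Data.List.Membership.Propositional as List
open import Data.List.Relation.Unary.All as All using (All; []; _∷_)
import Data.List.Relation.Unary.All.Properties as All
open import Data.List.Relation.Unary.AllPairs using ([]; _∷_)
open import Data.List.Relation.Unary.Any as Any using (here; there)
open import Data.List.Relation.Unary.Unique.Propositional using (Unique)
open import Data.Nat.Base using (ℕ; zero; suc; _+_; _*_; _∸_; _⊓_; _≤_; _<_; z≤n; s≤s; _≤ᵇ_; _≡ᵇ_)
open import Data.Nat.Induction using (<-wellFounded)
import Data.Nat.Properties as ℕ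
open import Data.Product.Base using (Σ; ∃; ∃₂; _×_; _,_; proj₁; proj₂)
open import Data.Sum.Base as Sum using (_⊎_; inj₁; inj₂; swap; [_,_]′)
open import Data.Unit.Base using (tt) renaming (⊤ to Unit)
open import Data.Vec.Base as Vec using (Vec; []; _∷_; here; there; _++_; lookup; tabulate)
open import Data.Vec.Properties using (lookup⇒[]=; []=⇒lookup; lookup∘tabulate; tabulate∘lookup; tabulate-cong)
open import Function.Base using (_∘_)
open import Function.Bundles using (Equivalence)
open import Induction.WellFounded using (Acc; acc)
open import Relation.Binary.Construct.Closure.ReflexiveTransitive using (Star; ε; _◅_)
open import Relation.Binary.Definitions using (Decidable; tri<; tri≈; tri>)
open import Relation.Binary.PropositionalEquality
  using (_≡_; _≢_; refl; sym; trans; cong; subst; subst₂; module ≡-Reasoning)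
open import Relation.Nullary using (¬_; Dec; yes; no; contradiction)
open import Relation.Nullary.Decidable using (map′; _×-dec_; _⊎-dec_; ¬?; decidable-stable)
open import Relation.Unary using (_≐_; _∖_)

open import Algebra.Properties.CommutativeMonoid.Sum ℕ.+-0-commutativeMonoid using (sum; sum-permute; sum-cong-≗)

private
  variable
    n r N : ℕ

-- Walks, geodesics and closed sets

module Walks {G : Graph n} (D : Orientation G) where
  open Graph G
  open Orientation D

  data Walk : Fin n → Fin n → ℕ → Set where
    nil  : ∀ {u} → Walk u u 0
    cons : ∀ {u v w m} → Arc u w → Walk w v m → Walk u v (suc m)

  infixr 5 _++ʷ_
  _++ʷ_ : ∀ {u v w a b} → Walk u v a → Walk v w b → Walk u w (a + b)
  nil ++ʷ q = q
  cons a p ++ʷ q = cons a (p ++ʷ q)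

  Strongly : Set
  Strongly = ∀ u v → ∃ (Walk u v)

  -- Minimality is demanded among all walks instead of simple paths. The two notions agree because a
  -- shortest walk repeats no vertex.
  Between : (u v w : Fin n) → Set
  Between u v w = ∃₂ λ a b → Walk u w a × Walk w v b × (∀ {m} → Walk u v m → a + b ≤ m)

  Closed : Subset n → Set
  Closed S = ∀ {u v w} → u ∈ S → v ∈ S → Between u v w → w ∈ S

  fromStar : ∀ {u v} (p : Star Arc u v) → Walk u v (walkLength D p)
  fromStar ε       = nil
  fromStar (a ◅ p) = cons a (fromStar p)

  toStar : ∀ {u v m} → Walk u v m → Σ (Star Arc u v) λ p → walkLength D p ≡ m
  toStar nil        = ε , refl
  toStar (cons a p) = let q , eq = toStar p in a ◅ q , cong suc eq

  splitStar : ∀ {u v w} (p : Star Arc u v) → w List.∈ vertices D p →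
              ∃₂ λ a b → Walk u w a × Walk w v b × a + b ≡ walkLength D p
  splitStar ε       (here refl) = 0 , 0 , nil , nil , refl
  splitStar (a ◅ p) (here refl) = 0 , _ , nil , fromStar (a ◅ p) , refl
  splitStar (a ◅ p) (there w∈)  =
    let i , j , q , r , eq = splitStar p w∈ in suc i , j , cons a q , r , cong suc eq

  start∈ : ∀ {u v} (p : Star Arc u v) → u List.∈ vertices D p
  start∈ ε       = here refl
  start∈ (_ ◅ _) = here refl

  joinStar : ∀ {u v w} (p : Star Arc u w) (q : Star Arc w v) →
             Σ (Star Arc u v) λ r → w List.∈ vertices D r × walkLength D r ≡ walkLength D p + walkLength D q
  joinStar ε       q = q , start∈ q , refl
  joinStar (a ◅ p) q = let r , w∈ , eq = joinStar p q in a ◅ r , there w∈ , cong suc eq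

  -- A first vertex that recurs later marks a closed detour, and cutting it out shortens the walk.
  simpleOrShorter : ∀ {u v} (p : Star Arc u v) →
                    Unique (vertices D p) ⊎ (Σ (Star Arc u v) λ q → walkLength D q < walkLength D p)
  simpleOrShorter ε = inj₁ ([] ∷ [])
  simpleOrShorter (_◅_ {u} a p) with simpleOrShorter p
  ... | inj₂ (q , q<p) = inj₂ (a ◅ q , s≤s q<p)
  ... | inj₁ uniq with ListDec._∈?_ Fin._≟_ u (vertices D p)
  ...   | no u∉ = inj₁ (All.¬Any⇒All¬ _ u∉ ∷ uniq)
  ...   | yes u∈ =
    let i , j , _ , r , eq = splitStar p u∈
        s , eq′ = toStar r
    in inj₂ (s , s≤s (subst₂ _≤_ (sym eq′) eq (ℕ.m≤n+m j i)))

  simplify : ∀ {u v} (p : Star Arc u v) →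
             Σ (DirectedPath D u v) λ q → walkLength D (DirectedPath.walk q) ≤ walkLength D p
  simplify p = go p (<-wellFounded _)
    where
    go : ∀ {u v} (p : Star Arc u v) → Acc _<_ (walkLength D p) →
         Σ (DirectedPath D u v) λ q → walkLength D (DirectedPath.walk q) ≤ walkLength D p
    go p (acc rec) with simpleOrShorter p
    ... | inj₁ uniq       = record { walk = p ; simple = uniq } , ℕ.≤-refl
    ... | inj₂ (q , q<p) = let r , r≤q = go q (rec q<p) in r , ℕ.≤-trans r≤q (ℕ.<⇒≤ q<p)

  strong⇒strongly : Strong D → Strongly
  strong⇒strongly st u v = _ , fromStar (DirectedPath.walk (st u v))

  strongly⇒strong : Strongly → Strong D
  strongly⇒strong st u v = proj₁ (simplify (proj₁ (toStar (proj₂ (st u v)))))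

  onGeodesic⇒between : ∀ {u v w} → OnGeodesic D u v w → Between u v w
  onGeodesic⇒between (p , geo , w∈) =
    let a , b , q , r , eq = splitStar (DirectedPath.walk p) w∈ in
    a , b , q , r , λ s →
      let t , t≡ = toStar s
          t′ , t′≤ = simplify t
      in subst₂ _≤_ (sym eq) t≡ (ℕ.≤-trans (geo t′) t′≤)

  between⇒onGeodesic : ∀ {u v w} → Between u v w → OnGeodesic D u v w
  between⇒onGeodesic (a , b , p , q , short) with toStar p | toStar q
  ... | p′ , refl | q′ , refl with joinStar p′ q′
  ...   | r , w∈ , eq with simpleOrShorter r
  -- By minimality the joined walk cannot be shortened, so only the simple case survives.
  ...     | inj₂ (s , s<r) = contradiction (subst (walkLength D s <_) eq s<r) (ℕ.≤⇒≯ (short (fromStar s)))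
  ...     | inj₁ uniq = record { walk = r ; simple = uniq }
            , (λ s → subst (_≤ _) (sym eq) (short (fromStar (DirectedPath.walk s))))
            , w∈

  convex⇒closed : ∀ {S} → Convex D S → Closed S
  convex⇒closed (_ , cl) u∈ v∈ btw = cl u∈ v∈ (inj₁ (between⇒onGeodesic btw))

  convex : ∀ {S} → Nonempty S → Closed S → Convex D S
  convex ne cl = ne , λ where
    u∈ v∈ (inj₁ g) → cl u∈ v∈ (onGeodesic⇒between g)
    u∈ v∈ (inj₂ g) → cl v∈ u∈ (onGeodesic⇒between g)

  Boundary : Subset n → Fin n → Set
  Boundary W f = f ∈ W × ∃ λ o → o ∉ W × (Arc f o ⊎ Arc o f)

  leave : ∀ {W u w m} → u ∈ W → w ∉ W → Walk u w m →
          ∃ λ f → Boundary W f × ∃₂ λ a b → Walk u f a × Walk f w b × a + b ≡ m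
  leave u∈ w∉ nil = contradiction u∈ w∉
  leave {W} u∈ w∉ (cons {w = x} a p) with x ∈? W
  ... | no x∉  = _ , (u∈ , _ , x∉ , inj₁ a) , 0 , _ , nil , cons a p , refl
  ... | yes x∈ = let f , bd , i , j , q , r , eq = leave x∈ w∉ p in
                 f , bd , suc i , j , cons a q , r , cong suc eq

  enter : ∀ {W w v m} → w ∉ W → v ∈ W → Walk w v m →
          ∃ λ f → Boundary W f × ∃₂ λ a b → Walk w f a × Walk f v b × a + b ≡ m
  enter w∉ v∈ nil = contradiction v∈ w∉
  enter {W} w∉ v∈ (cons {w = x} a p) with x ∈? W
  ... | yes x∈ = _ , (x∈ , _ , w∉ , inj₂ a) , 1 , _ , cons a nil , p , refl
  ... | no x∉  = let f , bd , i , j , q , r , eq = enter x∉ v∈ p in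
                 f , bd , suc i , j , cons a q , r , cong suc eq

  -- A shorter walk from `f` to `g`, spliced between `p` and `s`, would shorten the geodesic from
  -- `u` to `v`.
  between-sub : ∀ {u v w f g a b c d} → Walk u f a → Walk f w b → Walk w g c → Walk g v d →
                (∀ {m} → Walk u v m → (a + b) + (c + d) ≤ m) → Between f g w
  between-sub {a = a} {b} {c} {d} p q r s short = b , c , q , r , λ {m} t →
    ℕ.+-cancelˡ-≤ a _ _ (ℕ.+-cancelʳ-≤ d _ _ (ℕ.≤-trans (ℕ.≤-reflexive eq) (short₁ t)))
    where
    short₁ : ∀ {m} → Walk _ _ m → (a + b) + (c + d) ≤ (a + m) + d
    short₁ {m} t = ℕ.≤-trans (short (p ++ʷ t ++ʷ s)) (ℕ.≤-reflexive (sym (ℕ.+-assoc a m d)))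
    eq : (a + (b + c)) + d ≡ (a + b) + (c + d)
    eq = begin
      (a + (b + c)) + d ≡⟨ cong (_+ d) (sym (ℕ.+-assoc a b c)) ⟩
      ((a + b) + c) + d ≡⟨ ℕ.+-assoc (a + b) c d ⟩
      (a + b) + (c + d) ∎
      where open ≡-Reasoning

  -- f and g are the last vertex of W before w and the first one after it.
  excursion : ∀ {W u v w} → u ∈ W → v ∈ W → w ∉ W → Between u v w →
              ∃₂ λ f g → Boundary W f × Boundary W g × Between f g w
  excursion u∈ v∈ w∉ (a , b , p , q , short)
    with leave u∈ w∉ p | enter w∉ v∈ q
  ... | f , bf , _ , _ , p₁ , p₂ , refl | g , bg , _ , _ , q₁ , q₂ , refl =
    f , g , bf , bg , between-sub p₁ p₂ q₁ q₂ short

  -- If `w` lay outside `W`, it would lie on a geodesic between two boundary vertices of `W`. These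
  -- belong to `S`, so closedness of `S` puts `w` into `S`, hence into `W`.
  closed-superset : ∀ {S W} → Closed S → S ⊆ W → (∀ {f} → Boundary W f → f ∈ S) → Closed W
  closed-superset {S} {W} cl S⊆W bd {w = w} u∈ v∈ btw with w ∈? W
  ... | yes w∈ = w∈
  ... | no w∉  = let f , g , bf , bg , btw′ = excursion u∈ v∈ w∉ btw in S⊆W (cl (bd bf) (bd bg) btw′)

  module Decide (adj? : Decidable Adj) where

    arc? : Decidable Arc
    arc? u v with adj? u v
    ... | no ¬uv = no (¬uv ∘ arc⇒adj)
    ... | yes uv with adj⇒arc uv
    ...   | inj₁ a = yes a
    ...   | inj₂ a = no λ a′ → arc-asym a a′

    walk? : ∀ u v m → Dec (Walk u v m)
    walk? u v zero = map′ (λ { refl → nil }) (λ { nil → refl }) (u Fin.≟ v)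
    walk? u v (suc m) =
      map′ (λ (_ , a , p) → cons a p) (λ { (cons a p) → _ , a , p })
           (Fin.any? λ w → arc? u w ×-dec walk? w v m)

    shortest : ∀ {u v m} → Walk u v m → ∃ λ k → Walk u v k × (∀ {j} → Walk u v j → k ≤ j)
    shortest {u} {v} {m} p = search m 0 (ℕ.+-identityʳ m) λ _ → z≤n
      where
      search : ∀ i k → i + k ≡ m → (∀ {j} → Walk u v j → k ≤ j) →
               ∃ λ k → Walk u v k × (∀ {j} → Walk u v j → k ≤ j)
      -- The fuel `i` is `m ∸ k`; when it is used up, `k` equals `m` and `p` itself is shortest.
      search zero    k refl low = k , p , low
      search (suc i) k eq low with walk? u v k
      ... | yes q = k , q , low
      ... | no ¬q = search i (suc k) (trans (ℕ.+-suc i k) eq)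
                      λ r → ℕ.≤∧≢⇒< (low r) λ { refl → ¬q r }

    module _ (st : Strongly) {T} (cl : Closed T) where

      -- The second vertex of a geodesic from `u` to `v` lies in `T`.
      outNeighbour : ∀ {u v} → u ∈ T → v ∈ T → u ≢ v → ∃ λ w → w ∈ T × Arc u w
      outNeighbour {u} {v} u∈ v∈ u≢v with shortest (proj₂ (st u v))
      ... | _ , nil , _ = contradiction refl u≢v
      ... | _ , cons a p , low = _ , cl u∈ v∈ (1 , _ , cons a nil , p , low) , a

      -- Here it is the last but one vertex of the geodesic.
      inNeighbour : ∀ {u v} → u ∈ T → v ∈ T → u ≢ v → ∃ λ w → w ∈ T × Arc w v
      inNeighbour {u} {v} u∈ v∈ u≢v with shortest (proj₂ (st u v))
      ... | _ , nil , _ = contradiction refl u≢v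
      ... | _ , p@(cons _ _) , low with unsnoc p
        where
        unsnoc : ∀ {u v m} → Walk u v (suc m) → ∃ λ w → Walk u w m × Arc w v
        unsnoc (cons a nil) = _ , nil , a
        unsnoc (cons a p@(cons _ _)) = let w , q , b = unsnoc p in w , cons a q , b
      ...   | w , q , a = w , cl u∈ v∈ (_ , 1 , q , cons a nil , λ r → ℕ.≤-trans (ℕ.≤-reflexive (ℕ.+-comm _ 1)) (low r)) , a

  module Bipartite (colour : Fin n → Bool) (flip : ∀ {u v} → Adj u v → colour v ≡ not (colour u)) where

    flip₂ : ∀ {u v w} → Arc u v → Arc v w → colour w ≡ colour u
    flip₂ a b = trans (flip (arc⇒adj b)) (trans (cong not (flip (arc⇒adj a))) (not-involutive _))

    flip₃ : ∀ {u v w x} → Arc u v → Arc v w → Arc w x → colour x ≡ not (colour u)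
    flip₃ a b c = trans (flip (arc⇒adj c)) (cong not (flip₂ a b))

    -- Length 0 would give two opposite arcs, and length 1 has the wrong parity.
    between₂ : ∀ {u v w} → Arc u w → Arc w v → Between u v w
    between₂ {u} {v} a b = 1 , 1 , cons a nil , cons b nil , short
      where
      short : ∀ {m} → Walk u v m → 2 ≤ m
      short nil = contradiction b (arc-asym a)
      short (cons c nil) = contradiction (trans (sym (flip (arc⇒adj c))) (flip₂ a b)) (not-¬ refl ∘ sym)
      short (cons _ (cons _ _)) = s≤s (s≤s z≤n)

    module _ {u x y v} (a : Arc u x) (b : Arc x y) (c : Arc y v) (¬uv : ¬ Arc u v) where

      private
        -- Lengths 0 and 2 have the wrong parity, and length 1 is excluded by `¬uv`.
        short : ∀ {m} → Walk u v m → 3 ≤ m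
        short nil = contradiction (flip₃ a b c) (not-¬ refl)
        short (cons d nil) = contradiction d ¬uv
        short (cons d (cons e nil)) = contradiction (trans (sym (flip₃ a b c)) (flip₂ d e)) (not-¬ refl ∘ sym)
        short (cons _ (cons _ (cons _ _))) = s≤s (s≤s (s≤s z≤n))

      between₃ˡ : Between u v x
      between₃ˡ = 1 , 2 , cons a nil , cons b (cons c nil) , short

      between₃ʳ : Between u v y
      between₃ʳ = 2 , 1 , cons a (cons b nil) , cons c nil , short

    -- The path from `b` back to `a` through `c` and `d` is a geodesic, as the arc `ab` excludes an
    -- arc from `b` to `a`.
    square : ∀ {T a b c d} → Closed T → Arc a b → Arc b c → Arc c d → Arc d a →
             a ∈ T → b ∈ T → c ∈ T × d ∈ T
    square cl ab bc cd da a∈ b∈ =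
      cl b∈ a∈ (between₃ˡ bc cd da (arc-asym ab)) , cl b∈ a∈ (between₃ʳ bc cd da (arc-asym ab))

-- Grid edges

-- Vertices are numbered column by column, three per column, so three successors skip a column that
-- has been prepended.
pattern old u = suc (suc (suc u))

Grid : ∀ n → Graph (n * 3)
Grid n = P n □ P 3

module _ {n : ℕ} where
  open Graph (Grid n) public using (Adj)

-- Each edge occurs once, from its smaller to its larger end: `v₀` and `v₁` run down the first
-- column, `h₀`, `h₁` and `h₂` lead to the second one.
data Edge : ∀ n → Fin (n * 3) → Fin (n * 3) → Set where
  v₀ : Edge (suc n) 0F 1F
  v₁ : Edge (suc n) 1F 2F
  h₀ : Edge (suc (suc n)) 0F 3F
  h₁ : Edge (suc (suc n)) 1F 4F
  h₂ : Edge (suc (suc n)) 2F 5F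
  shift : ∀ {u v} → Edge n u v → Edge (suc n) (old u) (old v)

Edge± : ∀ n → Fin (n * 3) → Fin (n * 3) → Set
Edge± n u v = Edge n u v ⊎ Edge n v u

shift± : ∀ {u v} → Edge± n u v → Edge± (suc n) (old u) (old v)
shift± = Sum.map shift shift

edge⇒adj : ∀ {u v} → Edge n u v → Adj {n} u v
edge⇒adj v₀ = inj₁ (refl , inj₁ refl)
edge⇒adj v₁ = inj₁ (refl , inj₁ refl)
edge⇒adj h₀ = inj₂ (inj₁ refl , refl)
edge⇒adj h₁ = inj₂ (inj₁ refl , refl)
edge⇒adj h₂ = inj₂ (inj₁ refl , refl)
edge⇒adj (shift e) with edge⇒adj e
... | inj₁ (p , q)      = inj₁ (cong suc p , q)
... | inj₂ (inj₁ p , q) = inj₂ (inj₁ (cong suc p) , q)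
... | inj₂ (inj₂ p , q) = inj₂ (inj₂ (cong suc p) , q)

edge±⇒adj : ∀ {u v} → Edge± n u v → Adj {n} u v
edge±⇒adj {n} (inj₁ e) = edge⇒adj e
edge±⇒adj {n} (inj₂ e) = Graph.adj-sym (Grid n) (edge⇒adj e)

firstColumn : ∀ {u : Fin (n * 3)} {v : Fin (suc n * 3)} → Adj {suc n} v (old u) → quotient {suc n} 3 v ≡ zero →
              remainder {suc n} 3 v ≡ remainder {n} 3 u × toℕ (quotient {n} 3 u) ≡ 0
firstColumn (inj₁ (p , _)) q with () ← trans (sym q) p
firstColumn (inj₂ (inj₁ p , q)) eq = q , sym (ℕ.suc-injective (trans (cong (suc ∘ toℕ) (sym eq)) p))
firstColumn (inj₂ (inj₂ p , q)) eq with () ← trans p (cong toℕ eq)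

newOld : ∀ (u : Fin (n * 3)) j → quotient {suc n} 3 j ≡ zero → Adj {suc n} j (old u) → Edge± (suc n) j (old u)
-- The adjacency is replaced by equations between rows and columns, so that matching refutes the
-- impossible cases.
newOld {n} u j eq a = go n u j eq (firstColumn {n} {u} {j} a eq)
  where
  go : ∀ n (u : Fin (n * 3)) j → quotient {suc n} 3 j ≡ zero →
       remainder {suc n} 3 j ≡ remainder {n} 3 u × toℕ (quotient {n} 3 u) ≡ 0 → Edge± (suc n) j (old u)
  go (suc n) 0F 0F _ _ = inj₁ h₀
  go (suc n) 1F 1F _ _ = inj₁ h₁
  go (suc n) 2F 2F _ _ = inj₁ h₂
  go (suc n) 0F 1F _ (() , _)
  go (suc n) 0F 2F _ (() , _)
  go (suc n) 1F 0F _ (() , _)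
  go (suc n) 1F 2F _ (() , _)
  go (suc n) 2F 0F _ (() , _)
  go (suc n) 2F 1F _ (() , _)
  go (suc n) (old u) j _ (_ , ())

adj⇒edge± : ∀ n {u v} → Adj {n} u v → Edge± n u v
adj⇒edge± (suc n) {0F} {1F} _ = inj₁ v₀
adj⇒edge± (suc n) {1F} {0F} _ = inj₂ v₀
adj⇒edge± (suc n) {1F} {2F} _ = inj₁ v₁
adj⇒edge± (suc n) {2F} {1F} _ = inj₂ v₁
adj⇒edge± (suc n) {0F} {0F} a = contradiction a (Graph.adj-irrefl (Grid (suc n)) 0F)
adj⇒edge± (suc n) {1F} {1F} a = contradiction a (Graph.adj-irrefl (Grid (suc n)) 1F)
adj⇒edge± (suc n) {2F} {2F} a = contradiction a (Graph.adj-irrefl (Grid (suc n)) 2F)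
adj⇒edge± (suc n) {0F} {2F} (inj₁ (_ , inj₁ ()))
adj⇒edge± (suc n) {0F} {2F} (inj₁ (_ , inj₂ ()))
adj⇒edge± (suc n) {0F} {2F} (inj₂ (inj₁ () , _))
adj⇒edge± (suc n) {0F} {2F} (inj₂ (inj₂ () , _))
adj⇒edge± (suc n) {2F} {0F} (inj₁ (_ , inj₁ ()))
adj⇒edge± (suc n) {2F} {0F} (inj₁ (_ , inj₂ ()))
adj⇒edge± (suc n) {2F} {0F} (inj₂ (inj₁ () , _))
adj⇒edge± (suc n) {2F} {0F} (inj₂ (inj₂ () , _))
adj⇒edge± (suc n) {0F} {old v} a = newOld _ 0F refl a
adj⇒edge± (suc n) {1F} {old v} a = newOld _ 1F refl a
adj⇒edge± (suc n) {2F} {old v} a = newOld _ 2F refl a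
adj⇒edge± (suc n) {old u} {0F} a = swap (newOld _ 0F refl (Graph.adj-sym (Grid (suc n)) {old u} {0F} a))
adj⇒edge± (suc n) {old u} {1F} a = swap (newOld _ 1F refl (Graph.adj-sym (Grid (suc n)) {old u} {1F} a))
adj⇒edge± (suc n) {old u} {2F} a = swap (newOld _ 2F refl (Graph.adj-sym (Grid (suc n)) {old u} {2F} a))
adj⇒edge± (suc n) {old u} {old v} a = shift± (adj⇒edge± n (unshift a))
  where
  unshift : Adj {suc n} (old u) (old v) → Adj {n} u v
  unshift (inj₁ (p , q))      = inj₁ (Fin.suc-injective p , q)
  unshift (inj₂ (inj₁ p , q)) = inj₂ (inj₁ (ℕ.suc-injective p) , q)
  unshift (inj₂ (inj₂ p , q)) = inj₂ (inj₂ (ℕ.suc-injective p) , q)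

adj? : ∀ n → Decidable (Adj {n})
adj? n u v = (quotient {n} 3 u Fin.≟ quotient {n} 3 v) ×-dec path? (remainder {n} 3 u) (remainder {n} 3 v)
       ⊎-dec path? (quotient {n} 3 u) (quotient {n} 3 v) ×-dec (remainder {n} 3 u Fin.≟ remainder {n} 3 v)
  where
  path? : ∀ {m} → Decidable (Graph.Adj (P m))
  path? i j = (suc (toℕ i) ℕ.≟ toℕ j) ⊎-dec (suc (toℕ j) ℕ.≟ toℕ i)

-- Checkerboard colouring and half-turn of the edges

colour : ∀ n → Fin (n * 3) → Bool
colour (suc n) 0F      = true
colour (suc n) 1F      = false
colour (suc n) 2F      = true
colour (suc n) (old u) = not (colour n u)

edge-flips : ∀ {u v} → Edge n u v → colour n v ≡ not (colour n u)
edge-flips v₀        = refl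
edge-flips v₁        = refl
edge-flips h₀        = refl
edge-flips h₁        = refl
edge-flips h₂        = refl
edge-flips (shift e) = cong not (edge-flips e)

adj-flips : ∀ {u v} → Adj {n} u v → colour n v ≡ not (colour n u)
adj-flips {n} a with adj⇒edge± n a
... | inj₁ e = edge-flips e
... | inj₂ e = trans (sym (not-involutive _)) (cong not (sym (edge-flips e)))

-- Three applications of `inject₁` keep the number of a vertex while a column is added at the far
-- end. This is what `opposite` makes of `old`.
raise : ∀ {u v} → Edge n u v →
        Edge (suc n) (inject₁ (inject₁ (inject₁ u))) (inject₁ (inject₁ (inject₁ v)))
raise v₀        = v₀
raise v₁        = v₁
raise h₀        = h₀
raise h₁        = h₁
raise h₂        = h₂
raise (shift e) = shift (raise e)

-- `opposite` is the rotation by 180°. It reverses the numbering, hence swaps the ends of an edge,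
-- and takes edges at the first column to edges at the last one, which the local lemmas `last` reach
-- by recursion.
edge-opposite : ∀ {u v} → Edge n u v → Edge n (opposite v) (opposite u)
edge-opposite {suc n} v₀ = last n
  where
  last : ∀ n → Edge (suc n) (inject₁ (fromℕ (1 + n * 3))) (fromℕ (2 + n * 3))
  last zero    = v₁
  last (suc n) = shift (last n)
edge-opposite {suc n} v₁ = last n
  where
  last : ∀ n → Edge (suc n) (inject₁ (inject₁ (fromℕ (n * 3)))) (inject₁ (fromℕ (1 + n * 3)))
  last zero    = v₀
  last (suc n) = shift (last n)
edge-opposite {suc (suc n)} h₀ = last n
  where
  last : ∀ n → Edge (2 + n) (inject₁ (inject₁ (inject₁ (fromℕ (2 + n * 3))))) (fromℕ (5 + n * 3))
  last zero    = h₂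
  last (suc n) = shift (last n)
edge-opposite {suc (suc n)} h₁ = last n
  where
  last : ∀ n → Edge (2 + n) (inject₁ (inject₁ (inject₁ (inject₁ (fromℕ (1 + n * 3)))))) (inject₁ (fromℕ (4 + n * 3)))
  last zero    = h₁
  last (suc n) = shift (last n)
edge-opposite {suc (suc n)} h₂ = last n
  where
  last : ∀ n → Edge (2 + n) (inject₁ (inject₁ (inject₁ (inject₁ (inject₁ (fromℕ (n * 3)))))))
                            (inject₁ (inject₁ (fromℕ (3 + n * 3))))
  last zero    = h₀
  last (suc n) = shift (last n)
edge-opposite (shift e) = raise (edge-opposite e)

-- When u x y w is a directed path, it is a geodesic.
Open : ∀ n → Fin (n * 3) → Fin (n * 3) → Set
Open n x y = ∃₂ λ u w → Edge± n u x × Edge± n y w × u ≢ y × w ≢ x × ¬ Edge± n u w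

open-sym : ∀ {x y} → Open n x y → Open n y x
open-sym (u , w , ux , yw , u≢y , w≢x , ¬uw) = w , u , swap yw , swap ux , w≢x , u≢y , ¬uw ∘ swap

neither : ∀ {A B : Set} → ¬ A → ¬ B → ¬ (A ⊎ B)
neither f g (inj₁ a) = f a
neither f g (inj₂ b) = g b

old-injective : ∀ {m} {u v : Fin m} → _≡_ {A = Fin (3 + m)} (old u) (old v) → u ≡ v
old-injective refl = refl

shift-injective : ∀ {u v} → Edge± (suc n) (old u) (old v) → Edge± n u v
shift-injective (inj₁ (shift e)) = inj₁ e
shift-injective (inj₂ (shift e)) = inj₂ e

open-shift : ∀ {x y} → Edge n x y → Open (suc n) (old x) (old y)
open-shift v₀ = 0F , 5F , inj₁ h₀ , inj₁ (shift v₁) , (λ ()) , (λ ()) , neither (λ ()) (λ ())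
open-shift v₁ = 3F , 2F , inj₁ (shift v₀) , inj₂ h₂ , (λ ()) , (λ ()) , neither (λ ()) (λ ())
open-shift h₀ = 0F , 7F , inj₁ h₀ , inj₁ (shift (shift v₀)) , (λ ()) , (λ ()) , neither (λ ()) (λ ())
open-shift h₁ = 1F , 6F , inj₁ h₁ , inj₂ (shift (shift v₀)) , (λ ()) , (λ ()) , neither (λ ()) (λ ())
open-shift h₂ = 2F , 7F , inj₁ h₂ , inj₂ (shift (shift v₁)) , (λ ()) , (λ ()) , neither (λ ()) (λ ())
open-shift (shift e) =
  let u , w , ux , yw , u≢y , w≢x , ¬uw = open-shift e in
  old u , old w , shift± ux , shift± yw
  , u≢y ∘ old-injective , w≢x ∘ old-injective , ¬uw ∘ shift-injective

-- The outer edges of the path must not be opposite sides of a unit square, or its ends would be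
-- adjacent. Around a horizontal edge this takes a third column, which lies to the right here and to
-- the left in `open-shift`.
edge-open : ∀ {x y} → Edge (3 + n) x y → Open (3 + n) x y
edge-open v₀ = 3F , 2F , inj₂ h₀ , inj₁ v₁ , (λ ()) , (λ ()) , neither (λ ()) (λ ())
edge-open v₁ = 0F , 5F , inj₁ v₀ , inj₁ h₂ , (λ ()) , (λ ()) , neither (λ ()) (λ ())
edge-open h₀ = 1F , 6F , inj₂ v₀ , inj₁ (shift h₀) , (λ ()) , (λ ()) , neither (λ ()) (λ ())
edge-open h₁ = 0F , 7F , inj₁ v₀ , inj₁ (shift h₁) , (λ ()) , (λ ()) , neither (λ ()) (λ ())
edge-open h₂ = 1F , 8F , inj₁ v₁ , inj₁ (shift h₂) , (λ ()) , (λ ()) , neither (λ ()) (λ ())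
edge-open (shift e) = open-shift e

-- Sets in which every vertex has two neighbours

Outside₃ : Subset n → Set
Outside₃ S = ∃₂ λ x y → ∃ λ z → x ∉ S × y ∉ S × z ∉ S × y ≢ x × z ≢ x × z ≢ y

outside₃-size : {S : Subset n} → Outside₃ S → 3 + ∣ S ∣ ≤ n
outside₃-size {n} {S} (x , y , z , x∉ , y∉ , z∉ , y≢x , z≢x , z≢y) = begin
  3 + ∣ S ∣         ≤⟨ ℕ.+-monoˡ-≤ ∣ S ∣ big ⟩
  ∣ ∁ S ∣ + ∣ S ∣   ≡⟨ cong (_+ ∣ S ∣) (∣∁p∣≡n∸∣p∣ S) ⟩
  n ∸ ∣ S ∣ + ∣ S ∣ ≡⟨ ℕ.m∸n+n≡m (∣p∣≤n S) ⟩
  n                 ∎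
  where
  open ℕ.≤-Reasoning
  z∈ : z ∈ ∁ S - x - y
  z∈ = x∈p∧x≢y⇒x∈p-y (x∈p∧x≢y⇒x∈p-y (x∉p⇒x∈∁p z∉) z≢x) z≢y
  big : 3 ≤ ∣ ∁ S ∣
  big = ℕ.≤-trans (s≤s (ℕ.≤-trans (s≤s (ℕ.≤-trans (s≤s z≤n)
          (x∈p⇒∣p-x∣<∣p∣ z∈)))
          (x∈p⇒∣p-x∣<∣p∣ (x∈p∧x≢y⇒x∈p-y (x∉p⇒x∈∁p y∉) y≢x))))
          (x∈p⇒∣p-x∣<∣p∣ (x∉p⇒x∈∁p x∉))

another : ∀ {S : Subset n} {v} → v ∈ S → 2 ≤ ∣ S ∣ → ∃ λ u → u ∈ S × u ≢ v
another {S = S} {v} v∈ big with Fin.any? (λ u → (u ∈? S) ×-dec ¬? (u Fin.≟ v))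
... | yes found = found
... | no ¬found = contradiction (p⊆q⇒∣p∣≤∣q∣ S⊆v) (ℕ.<⇒≱ (subst (_< ∣ S ∣) (sym (∣⁅x⁆∣≡1 v)) big))
  where
  S⊆v : S ⊆ ⁅ v ⁆
  S⊆v {u} u∈ with u Fin.≟ v
  ... | yes refl = x∈⁅x⁆ v
  ... | no u≢v  = contradiction (u , u∈ , u≢v) ¬found

Column : Set
Column = Vec Bool 3

blank full : Column
blank = false ∷ false ∷ false ∷ []
full = true ∷ true ∷ true ∷ []

-- Past the last column an empty one is assumed, so that the end of the grid obeys the same local
-- condition.
next : ∀ n → Subset (n * 3) → Column
next zero    _               = blank
next (suc n) (a ∷ b ∷ c ∷ _) = a ∷ b ∷ c ∷ []

_⇒ᵇ_ : Bool → Bool → Bool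
a ⇒ᵇ b = not a ∨ b
infixr 4 _⇒ᵇ_

two : Vec Bool 4 → Bool
two v = 2 ≤ᵇ ∣ v ∣

-- Every member of the middle column has two neighbours in the set. Cells at the top and at the
-- bottom have at most three neighbours, and `false` fills their fourth slot.
fits : Column → Column → Column → Bool
fits (p ∷ q ∷ r ∷ []) (a ∷ b ∷ c ∷ []) (x ∷ y ∷ z ∷ []) =
  (a ⇒ᵇ two (p ∷ b ∷ x ∷ false ∷ [])) ∧ (b ⇒ᵇ two (q ∷ a ∷ c ∷ y ∷ [])) ∧ (c ⇒ᵇ two (r ∷ b ∷ z ∷ false ∷ []))

Rich : Column → ∀ n → Subset (n * 3) → Set
Rich _ zero    _               = Unit
Rich p (suc n) (a ∷ b ∷ c ∷ S) = T (fits p (a ∷ b ∷ c ∷ []) (next n S)) × Rich (a ∷ b ∷ c ∷ []) n S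

TwoNeighbours : ∀ n → Subset (n * 3) → Fin (n * 3) → Set
TwoNeighbours n S v = ∃₂ λ x y → x ≢ y × (x ∈ S × Edge± n v x) × (y ∈ S × Edge± n v y)

two-slots : ∀ {v : Vec Bool 4} {i j} → i ≢ j → i ∈ v → j ∈ v → T (two v)
two-slots {v} {i} {j} i≢j i∈ j∈ = ℕ.≤⇒≤ᵇ
  (ℕ.≤-trans (s≤s (ℕ.≤-trans (s≤s z≤n) (x∈p⇒∣p-x∣<∣p∣ (x∈p∧x≢y⇒x∈p-y i∈ i≢j)))) (x∈p⇒∣p-x∣<∣p∣ j∈))

-- `place` names the possible neighbour recorded in each slot of `s`; two different neighbours
-- occupy two different slots.
rich-vertex : ∀ {S : Subset (n * 3)} {v : Fin (n * 3)} (s : Vec Bool 4) (place : Fin 4 → Fin (n * 3)) →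
              (∀ {x} → Edge± n v x → x ∈ S → ∃ λ i → i ∈ s × x ≡ place i) →
              TwoNeighbours n S v → T (two s)
rich-vertex s place slot (x , y , x≢y , (x∈ , vx) , (y∈ , vy)) =
  let i , i∈ , x≡ = slot vx x∈
      j , j∈ , y≡ = slot vy y∈
  in two-slots (λ i≡j → x≢y (trans x≡ (trans (cong place i≡j) (sym y≡)))) i∈ j∈

⇒ᵇ-intro : ∀ {a b} → (a ≡ true → T b) → T (a ⇒ᵇ b)
⇒ᵇ-intro {false} _ = tt
⇒ᵇ-intro {true}  f = f refl

fits-intro : ∀ {p q r a b c x y z} →
             (a ≡ true → T (two (p ∷ b ∷ x ∷ false ∷ []))) →
             (b ≡ true → T (two (q ∷ a ∷ c ∷ y ∷ []))) →
             (c ≡ true → T (two (r ∷ b ∷ z ∷ false ∷ []))) →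
             T (fits (p ∷ q ∷ r ∷ []) (a ∷ b ∷ c ∷ []) (x ∷ y ∷ z ∷ []))
fits-intro f g h = Equivalence.from T-∧ (⇒ᵇ-intro f , Equivalence.from T-∧ (⇒ᵇ-intro g , ⇒ᵇ-intro h))

fits-first : ∀ n {p q r a b c} {S : Subset (n * 3)} → let S⁺ = p ∷ q ∷ r ∷ a ∷ b ∷ c ∷ S in
  (∀ {v} → old v ∈ S⁺ → TwoNeighbours (2 + n) S⁺ (old v)) → T (fits (p ∷ q ∷ r ∷ []) (a ∷ b ∷ c ∷ []) (next n S))
fits-first zero {p} {q} {r} {a} {b} {c} {S} tn =
  fits-intro {p} {q} {r} {a} {b} {c} {false} {false} {false}
    (λ { refl → rich-vertex (p ∷ b ∷ false ∷ false ∷ []) (λ { 0F → 0F ; 1F → 4F ; 2F → 0F ; 3F → 0F }) (λ where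
      (inj₂ h₀) here → 0F , here , refl
      (inj₂ (shift ()))
      (inj₁ (shift v₀)) (there (there (there (there here)))) → 1F , there here , refl)
      (tn (there (there (there here)))) })
    (λ { refl → rich-vertex (q ∷ a ∷ c ∷ false ∷ []) (λ { 0F → 1F ; 1F → 3F ; 2F → 5F ; 3F → 0F }) (λ where
      (inj₂ h₁) (there here) → 0F , here , refl
      (inj₂ (shift v₀)) (there (there (there here))) → 1F , there here , refl
      (inj₁ (shift v₁)) (there (there (there (there (there here))))) → 2F , there (there here) , refl)
      (tn (there (there (there (there here))))) })
    (λ { refl → rich-vertex (r ∷ b ∷ false ∷ false ∷ []) (λ { 0F → 2F ; 1F → 4F ; 2F → 0F ; 3F → 0F }) (λ where
      (inj₂ h₂) (there (there here)) → 0F , here , refl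
      (inj₁ (shift ()))
      (inj₂ (shift v₁)) (there (there (there (there here)))) → 1F , there here , refl)
      (tn (there (there (there (there (there here)))))) })
fits-first (suc n) {p} {q} {r} {a} {b} {c} {x ∷ y ∷ z ∷ S} tn =
  fits-intro {p} {q} {r} {a} {b} {c} {x} {y} {z}
    (λ { refl → rich-vertex (p ∷ b ∷ x ∷ false ∷ []) (λ { 0F → 0F ; 1F → 4F ; 2F → 6F ; 3F → 0F }) (λ where
      (inj₂ h₀) here → 0F , here , refl
      (inj₂ (shift ()))
      (inj₁ (shift v₀)) (there (there (there (there here)))) → 1F , there here , refl
      (inj₁ (shift h₀)) (there (there (there (there (there (there here)))))) → 2F , there (there here) , refl)
      (tn (there (there (there here)))) })
    (λ { refl → rich-vertex (q ∷ a ∷ c ∷ y ∷ []) (λ { 0F → 1F ; 1F → 3F ; 2F → 5F ; 3F → 7F }) (λ where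
      (inj₂ h₁) (there here) → 0F , here , refl
      (inj₂ (shift v₀)) (there (there (there here))) → 1F , there here , refl
      (inj₁ (shift v₁)) (there (there (there (there (there here))))) → 2F , there (there here) , refl
      (inj₁ (shift h₁)) (there (there (there (there (there (there (there here))))))) →
        3F , there (there (there here)) , refl)
      (tn (there (there (there (there here))))) })
    (λ { refl → rich-vertex (r ∷ b ∷ z ∷ false ∷ []) (λ { 0F → 2F ; 1F → 4F ; 2F → 8F ; 3F → 0F }) (λ where
      (inj₂ h₂) (there (there here)) → 0F , here , refl
      (inj₂ (shift v₁)) (there (there (there (there here)))) → 1F , there here , refl
      (inj₁ (shift h₂)) (there (there (there (there (there (there (there (there here)))))))) →
        2F , there (there here) , refl)
      (tn (there (there (there (there (there here)))))) })

-- The assumption concerns `old` vertices alone: the column on the left is context, and its own left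
-- neighbours are out of sight.
rich : ∀ n {p q r} {S : Subset (n * 3)} →
       (∀ {v} → old v ∈ p ∷ q ∷ r ∷ S → TwoNeighbours (suc n) (p ∷ q ∷ r ∷ S) (old v)) → Rich (p ∷ q ∷ r ∷ []) n S
rich zero _ = tt
rich (suc n) {S = a ∷ b ∷ c ∷ S} tn = fits-first n tn , rich n λ v∈ → unshift (tn (there (there (there v∈))))
  where
  unshift : ∀ {v} → TwoNeighbours (2 + n) (_ ∷ _ ∷ _ ∷ a ∷ b ∷ c ∷ S) (old (old v)) →
            TwoNeighbours (suc n) (a ∷ b ∷ c ∷ S) (old v)
  unshift (x , y , x≢y , (x∈ , vx) , (y∈ , vy)) with inner vx | inner vy
    where
    inner : ∀ {v x} → Edge± (2 + n) (old (old v)) x → ∃ λ x′ → x ≡ old x′ × Edge± (suc n) (old v) x′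
    inner (inj₁ (shift e)) = _ , refl , inj₁ e
    inner (inj₂ (shift e)) = _ , refl , inj₂ e
  ... | x′ , refl , vx′ | y′ , refl , vy′ =
    x′ , y′ , (λ { refl → x≢y refl }) , (drop x∈ , vx′) , (drop y∈ , vy′)
    where
    drop : ∀ {x′} → old x′ ∈ _ ∷ _ ∷ _ ∷ a ∷ b ∷ c ∷ S → x′ ∈ a ∷ b ∷ c ∷ S
    drop (there (there (there x∈))) = x∈

-- Classification of small sets by exhaustion

allᵇ : ∀ n → (Vec Bool n → Bool) → Bool
allᵇ zero    f = f []
allᵇ (suc n) f = allᵇ n (f ∘ (true ∷_)) ∧ allᵇ n (f ∘ (false ∷_))

-- For a concrete `f` the hypothesis is proved by `tt`, as evaluation tries all Boolean vectors.
exhaust : ∀ {n} {f} → T (allᵇ n f) → ∀ v → T (f v)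
exhaust t [] = t
exhaust t (true ∷ v)  = exhaust (proj₁ (Equivalence.to T-∧ t)) v
exhaust t (false ∷ v) = exhaust (proj₂ (Equivalence.to T-∧ t)) v

⇒ᵇ-elim : ∀ {a b} → T (a ⇒ᵇ b) → T a → T b
⇒ᵇ-elim {true} t _ = t

size-++ : ∀ {m} (p : Subset m) (q : Subset n) → ∣ p ++ q ∣ ≡ ∣ p ∣ + ∣ q ∣
size-++ []          q = refl
size-++ (true ∷ p)  q = cong suc (size-++ p q)
size-++ (false ∷ p) q = size-++ p q

next-⊥ : ∀ n → next n ⊥ ≡ blank
next-⊥ zero    = refl
next-⊥ (suc n) = refl

some : Column → Bool
some c = 1 ≤ᵇ ∣ c ∣

nonempty-++ : ∀ {c : Column} {S : Subset n} → Nonempty (c ++ S) → ¬ Nonempty S → T (some c)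
nonempty-++ {c = true ∷ _ ∷ _ ∷ []} _ _ = tt
nonempty-++ {c = false ∷ true ∷ _ ∷ []} _ _ = tt
nonempty-++ {c = false ∷ false ∷ true ∷ []} _ _ = tt
nonempty-++ {c = false ∷ false ∷ false ∷ []} (_ , there (there (there x∈))) ¬S = contradiction (_ , x∈) ¬S

last-two : ∀ p c → T (fits p c blank) → T (some c) → 4 ≤ ∣ p ∣ + ∣ c ∣
last-two p@(p₀ ∷ p₁ ∷ p₂ ∷ []) c@(c₀ ∷ c₁ ∷ c₂ ∷ []) fit ne = ℕ.≤ᵇ⇒≤ _ _
  (⇒ᵇ-elim {some c} (⇒ᵇ-elim {fits p c blank} (exhaust {6} {λ { (p₀ ∷ p₁ ∷ p₂ ∷ c₀ ∷ c₁ ∷ c₂ ∷ []) →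
    let p = p₀ ∷ p₁ ∷ p₂ ∷ [] ; c = c₀ ∷ c₁ ∷ c₂ ∷ [] in
    fits p c blank ⇒ᵇ some c ⇒ᵇ (4 ≤ᵇ (∣ p ∣ + ∣ c ∣)) }} tt (p₀ ∷ p₁ ∷ p₂ ∷ c₀ ∷ c₁ ∷ c₂ ∷ [])) fit) ne)

first-two : ∀ c d → T (fits blank c d) → T (some c) → 4 ≤ ∣ c ∣ + ∣ d ∣
first-two c@(c₀ ∷ c₁ ∷ c₂ ∷ []) d@(d₀ ∷ d₁ ∷ d₂ ∷ []) fit ne = ℕ.≤ᵇ⇒≤ _ _
  (⇒ᵇ-elim {some c} (⇒ᵇ-elim {fits blank c d} (exhaust {6} {λ { (c₀ ∷ c₁ ∷ c₂ ∷ d₀ ∷ d₁ ∷ d₂ ∷ []) →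
    let c = c₀ ∷ c₁ ∷ c₂ ∷ [] ; d = d₀ ∷ d₁ ∷ d₂ ∷ [] in
    fits blank c d ⇒ᵇ some c ⇒ᵇ (4 ≤ᵇ (∣ c ∣ + ∣ d ∣)) }} tt (c₀ ∷ c₁ ∷ c₂ ∷ d₀ ∷ d₁ ∷ d₂ ∷ [])) fit) ne)

-- The last nonempty column is followed by an empty one, so together with the column before it it
-- has four members by `last-two`. That earlier column may be `p`, which is therefore counted.
right-end : ∀ p n (S : Subset (n * 3)) → Rich p n S → Nonempty S → 4 ≤ ∣ p ∣ + ∣ S ∣
right-end p zero [] _ (() , _)
right-end p (suc n) (a ∷ b ∷ c ∷ S) (fit , rs) ne with nonempty? S
... | yes neS = ℕ.≤-trans (subst (4 ≤_) (sym (size-++ (a ∷ b ∷ c ∷ []) S)) (right-end _ n S rs neS)) (ℕ.m≤n+m _ ∣ p ∣)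
... | no ¬neS with Empty-unique ¬neS
...   | refl = ℕ.≤-trans (last-two p (a ∷ b ∷ c ∷ []) (subst (T ∘ fits p _) (next-⊥ n) fit) (nonempty-++ ne ¬neS))
                 (ℕ.+-monoʳ-≤ ∣ p ∣ (subst (∣ a ∷ b ∷ c ∷ [] ∣ ≤_) (sym (size-++ (a ∷ b ∷ c ∷ []) (⊥ {n * 3}))) (ℕ.m≤m+n _ _)))

-- Two squares that meet in the centre of a block show up as columns with 2, 3 and 2 members. The
-- columns `S` behind the block are arbitrary, since `widen` fills them.
data Pinched : ∀ n → Subset (n * 3) → Set where
  here : ∀ {n} (c d : Column) {S : Subset (n * 3)} → ∣ c ∣ ≡ 2 → ∣ d ∣ ≡ 2 → Pinched (3 + n) (c ++ full ++ d ++ S)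
  skip : ∀ {n} {S : Subset (n * 3)} → Pinched n S → Pinched (suc n) (blank ++ S)

Allowed : ∀ n → Subset (n * 3) → Set
Allowed n S = T (∣ S ∣ ≡ᵇ 4) ⊎ T (∣ S ∣ ≡ᵇ 6) ⊎ (∣ S ∣ ≡ 7 × Pinched n S) ⊎ 8 ≤ ∣ S ∣

-- All 512 patterns of three columns are tried; the admissible ones with seven members have column
-- sizes 2, 3 and 2.
pinch : ∀ {n} c d e → T (fits blank c d) → T (fits c d e) → T (fits d e blank) → T (some c) →
        Allowed (3 + n) (c ++ d ++ e ++ ⊥)
pinch {n} c@(c₀ ∷ c₁ ∷ c₂ ∷ []) d@(d₀ ∷ d₁ ∷ d₂ ∷ []) e@(e₀ ∷ e₁ ∷ e₂ ∷ []) fit₁ fit₂ fit₃ ne =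
  outcome (subst (λ s → T (test s c d e)) (sym total)
    (⇒ᵇ-elim {some c} (⇒ᵇ-elim {fits d e blank} (⇒ᵇ-elim {fits c d e} (⇒ᵇ-elim {fits blank c d}
      (exhaust {9} {λ { (c₀ ∷ c₁ ∷ c₂ ∷ d₀ ∷ d₁ ∷ d₂ ∷ e₀ ∷ e₁ ∷ e₂ ∷ []) →
        let c = c₀ ∷ c₁ ∷ c₂ ∷ [] ; d = d₀ ∷ d₁ ∷ d₂ ∷ [] ; e = e₀ ∷ e₁ ∷ e₂ ∷ [] in
        fits blank c d ⇒ᵇ fits c d e ⇒ᵇ fits d e blank ⇒ᵇ some c ⇒ᵇ test (∣ c ∣ + (∣ d ∣ + ∣ e ∣)) c d e }} tt
        (c₀ ∷ c₁ ∷ c₂ ∷ d₀ ∷ d₁ ∷ d₂ ∷ e₀ ∷ e₁ ∷ e₂ ∷ [])) fit₁) fit₂) fit₃) ne))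
  where
  test : ℕ → Column → Column → Column → Bool
  test s c d e = (s ≡ᵇ 4) ∨ (s ≡ᵇ 6) ∨ ((s ≡ᵇ 7) ∧ (∣ c ∣ ≡ᵇ 2) ∧ (∣ d ∣ ≡ᵇ 3) ∧ (∣ e ∣ ≡ᵇ 2)) ∨ (8 ≤ᵇ s)
  total : ∣ c ++ d ++ e ++ ⊥ {n * 3} ∣ ≡ ∣ c ∣ + (∣ d ∣ + ∣ e ∣)
  total = trans (size-++ c (d ++ e ++ ⊥ {n * 3})) (cong (∣ c ∣ +_) (trans (size-++ d (e ++ ⊥ {n * 3})) (cong (∣ d ∣ +_)
            (trans (size-++ e (⊥ {n * 3})) (trans (cong (∣ e ∣ +_) (∣⊥∣≡0 (n * 3))) (ℕ.+-identityʳ _))))))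
  outcome : T (test ∣ c ++ d ++ e ++ ⊥ {n * 3} ∣ c d e) → Allowed (3 + n) (c ++ d ++ e ++ ⊥)
  outcome t with Equivalence.to T-∨ t
  ... | inj₁ four = inj₁ four
  ... | inj₂ t₁ with Equivalence.to T-∨ t₁
  ...   | inj₁ six = inj₂ (inj₁ six)
  ...   | inj₂ t₂ with Equivalence.to T-∨ t₂
  ...     | inj₂ eight = inj₂ (inj₂ (inj₂ (ℕ.≤ᵇ⇒≤ _ _ eight)))
  ...     | inj₁ seven with Equivalence.to T-∧ seven
  ...       | s≡7 , rest with Equivalence.to T-∧ rest
  ...         | c≡2 , rest′ with Equivalence.to T-∧ rest′
  ...           | d≡3 , e≡2 = inj₂ (inj₂ (inj₁ (ℕ.≡ᵇ⇒≡ _ 7 s≡7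
                , subst (λ d → Pinched (3 + n) (c ++ d ++ e ++ ⊥)) (sym (∣p∣≡n⇒p≡⊤ {p = d} (ℕ.≡ᵇ⇒≡ ∣ d ∣ 3 d≡3)))
                    (here c e (ℕ.≡ᵇ⇒≡ ∣ c ∣ 2 c≡2) (ℕ.≡ᵇ⇒≡ ∣ e ∣ 2 e≡2)))))

pair : ∀ {n} c d → T (fits blank c d) → T (fits c d blank) → T (some c) →
       Allowed (2 + n) (c ++ d ++ ⊥)
pair {n} c@(c₀ ∷ c₁ ∷ c₂ ∷ []) d@(d₀ ∷ d₁ ∷ d₂ ∷ []) fit₁ fit₂ ne =
  outcome (subst (T ∘ test) (sym total)
    (⇒ᵇ-elim {some c} (⇒ᵇ-elim {fits c d blank} (⇒ᵇ-elim {fits blank c d}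
      (exhaust {6} {λ { (c₀ ∷ c₁ ∷ c₂ ∷ d₀ ∷ d₁ ∷ d₂ ∷ []) →
        let c = c₀ ∷ c₁ ∷ c₂ ∷ [] ; d = d₀ ∷ d₁ ∷ d₂ ∷ [] in
        fits blank c d ⇒ᵇ fits c d blank ⇒ᵇ some c ⇒ᵇ test (∣ c ∣ + ∣ d ∣) }} tt
        (c₀ ∷ c₁ ∷ c₂ ∷ d₀ ∷ d₁ ∷ d₂ ∷ [])) fit₁) fit₂) ne))
  where
  test : ℕ → Bool
  test s = (s ≡ᵇ 4) ∨ (s ≡ᵇ 6)
  total : ∣ c ++ d ++ ⊥ {n * 3} ∣ ≡ ∣ c ∣ + ∣ d ∣
  total = trans (size-++ c (d ++ ⊥ {n * 3})) (cong (∣ c ∣ +_) (trans (size-++ d (⊥ {n * 3}))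
            (trans (cong (∣ d ∣ +_) (∣⊥∣≡0 (n * 3))) (ℕ.+-identityʳ _))))
  outcome : T (test ∣ c ++ d ++ ⊥ {n * 3} ∣) → Allowed (2 + n) (c ++ d ++ ⊥)
  outcome t with Equivalence.to T-∨ t
  ... | inj₁ four = inj₁ four
  ... | inj₂ six  = inj₂ (inj₁ six)

-- `c` is the first nonempty column. If the set ends within three columns, a finite check decides.
-- Otherwise the first two columns and the remaining ones contribute at least four members each.
start : ∀ n c (S : Subset (n * 3)) → T (some c) → Rich blank (suc n) (c ++ S) → Allowed (suc n) (c ++ S)
start zero c@(_ ∷ _ ∷ _ ∷ []) [] ne (fit , _) =
  contradiction (∣p∣≤n c) (ℕ.<⇒≱ (last-two blank c fit ne))
start (suc n) c@(_ ∷ _ ∷ _ ∷ []) (d₀ ∷ d₁ ∷ d₂ ∷ S) ne (fit₁ , fit₂ , rs) with nonempty? S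
... | no ¬neS with Empty-unique ¬neS
...   | refl = pair c (d₀ ∷ d₁ ∷ d₂ ∷ []) fit₁ (subst (T ∘ fits c _) (next-⊥ n) fit₂) ne
start (suc zero) (_ ∷ _ ∷ _ ∷ []) (d₀ ∷ d₁ ∷ d₂ ∷ []) ne (fit₁ , fit₂ , rs) | yes (() , _)
start (suc (suc n)) c@(_ ∷ _ ∷ _ ∷ []) (d₀ ∷ d₁ ∷ d₂ ∷ e₀ ∷ e₁ ∷ e₂ ∷ S) ne (fit₁ , fit₂ , fit₃ , rs) | yes _ with nonempty? S
... | no ¬neS with Empty-unique ¬neS
...   | refl = pinch c d e fit₁ fit₂ (subst (T ∘ fits _ _) (next-⊥ n) fit₃) ne
  where
  d = d₀ ∷ d₁ ∷ d₂ ∷ []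
  e = e₀ ∷ e₁ ∷ e₂ ∷ []
start (suc (suc n)) c@(_ ∷ _ ∷ _ ∷ []) (d₀ ∷ d₁ ∷ d₂ ∷ e₀ ∷ e₁ ∷ e₂ ∷ S) ne (fit₁ , fit₂ , fit₃ , rs) | yes _ | yes neS =
  inj₂ (inj₂ (inj₂ (begin
    8                              ≤⟨ ℕ.+-mono-≤ (first-two c d fit₁ ne) (right-end e n S rs neS) ⟩
    (∣ c ∣ + ∣ d ∣) + (∣ e ∣ + ∣ S ∣) ≡⟨ ℕ.+-assoc ∣ c ∣ _ _ ⟩
    ∣ c ∣ + (∣ d ∣ + (∣ e ∣ + ∣ S ∣)) ≡⟨ cong (λ s → ∣ c ∣ + (∣ d ∣ + s)) (size-++ e S) ⟨
    ∣ c ∣ + (∣ d ∣ + ∣ e ++ S ∣)     ≡⟨ cong (∣ c ∣ +_) (size-++ d (e ++ S)) ⟨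
    ∣ c ∣ + ∣ d ++ e ++ S ∣         ≡⟨ size-++ c (d ++ e ++ S) ⟨
    ∣ c ++ d ++ e ++ S ∣           ∎)))
  where
  open ℕ.≤-Reasoning
  d = d₀ ∷ d₁ ∷ d₂ ∷ []
  e = e₀ ∷ e₁ ∷ e₂ ∷ []

classify : ∀ n (S : Subset (n * 3)) → Rich blank n S → Nonempty S → Allowed n S
classify zero [] _ (() , _)
classify (suc n) (false ∷ false ∷ false ∷ S) (_ , rs) (_ , there (there (there x∈))) with classify n S rs (_ , x∈)
... | inj₁ s                     = inj₁ s
... | inj₂ (inj₁ s)              = inj₂ (inj₁ s)
... | inj₂ (inj₂ (inj₁ (s , p))) = inj₂ (inj₂ (inj₁ (s , skip p)))
... | inj₂ (inj₂ (inj₂ s))       = inj₂ (inj₂ (inj₂ s))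
classify (suc n) (true ∷ b ∷ c ∷ S) rs ne = start n (true ∷ b ∷ c ∷ []) S tt rs
classify (suc n) (false ∷ true ∷ c ∷ S) rs ne = start n (false ∷ true ∷ c ∷ []) S tt rs
classify (suc n) (false ∷ false ∷ true ∷ S) rs ne = start n (false ∷ false ∷ true ∷ []) S tt rs

-- Filling all columns to the right of the full one adds no boundary vertices.
record Widening n (S : Subset (n * 3)) : Set where
  field
    W        : Subset (n * 3)
    S⊆W      : S ⊆ W
    grown    : ∃ λ x → x ∈ W × x ∉ S
    proper   : ∃ λ y → y ∉ W
    boundary : ∀ {f o} → f ∈ W → o ∉ W → Edge± n f o → f ∈ S
    first    : next n W ≡ next n S

missing : ∀ (c : Column) → ∣ c ∣ ≡ 2 → ∃ λ i → i ∉ c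
missing (false ∷ _ ∷ _ ∷ []) _ = 0F , λ ()
missing (true ∷ false ∷ _ ∷ []) _ = 1F , λ { (there ()) }
missing (true ∷ true ∷ false ∷ []) _ = 2F , λ { (there (there ())) }

widen : ∀ {n} {S : Subset (n * 3)} → Pinched n S → Widening n S
widen (here {n} (c₀ ∷ c₁ ∷ c₂ ∷ []) (d₀ ∷ d₁ ∷ d₂ ∷ []) {S} c≡2 d≡2) = record
  { W        = c ++ full ++ full ++ ⊤
  ; S⊆W      = λ { here → here ; (there here) → there here ; (there (there here)) → there (there here)
                 ; (there (there (there x∈))) → there (there (there ∈⊤)) }
  ; grown    = grown (missing d d≡2)
  ; proper   = proper (missing c c≡2)
  ; boundary = boundary
  ; first    = refl
  }
  where
  c = c₀ ∷ c₁ ∷ c₂ ∷ []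
  d = d₀ ∷ d₁ ∷ d₂ ∷ []
  W S′ : Subset ((3 + n) * 3)
  W = c ++ full ++ full ++ ⊤
  S′ = c ++ full ++ d ++ S
  grown : (∃ λ i → i ∉ d) → ∃ λ x → x ∈ W × x ∉ S′
  grown (0F , i∉) = 6F , there (there (there ∈⊤)) , λ { (there (there (there (there (there (there here)))))) → i∉ here }
  grown (1F , i∉) = 7F , there (there (there ∈⊤)) , λ { (there (there (there (there (there (there (there here))))))) → i∉ (there here) }
  grown (2F , i∉) = 8F , there (there (there ∈⊤)) , λ { (there (there (there (there (there (there (there (there here)))))))) → i∉ (there (there here)) }
  proper : (∃ λ i → i ∉ c) → ∃ λ y → y ∉ W
  proper (0F , i∉) = 0F , λ { here → i∉ here }
  proper (1F , i∉) = 1F , λ { (there here) → i∉ (there here) }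
  proper (2F , i∉) = 2F , λ { (there (there here)) → i∉ (there (there here)) }
  boundary : ∀ {f o} → f ∈ W → o ∉ W → Edge± (3 + n) f o → f ∈ S′
  boundary here _ _ = here
  boundary (there here) _ _ = there here
  boundary (there (there here)) _ _ = there (there here)
  -- All columns after `c` are filled, so a missing vertex lies in column `c`, and its neighbours
  -- lie in `c` or in the full column.
  boundary {o = old o} _ o∉ _ = contradiction (there (there (there ∈⊤))) o∉
  boundary {o = 0F} (there (there (there f∈))) _ (inj₂ h₀) = there (there (there here))
  boundary {o = 1F} (there (there (there f∈))) _ (inj₂ h₁) = there (there (there (there here)))
  boundary {o = 2F} (there (there (there f∈))) _ (inj₂ h₂) = there (there (there (there (there here))))
widen {suc n} (skip {S = S} p) = record
  { W        = blank ++ V.W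
  ; S⊆W      = λ { (there (there (there x∈))) → there (there (there (V.S⊆W x∈))) }
  ; grown    = let x , x∈ , x∉ = V.grown in
               old x , there (there (there x∈)) , λ { (there (there (there x∈S))) → x∉ x∈S }
  ; proper   = 0F , λ ()
  ; boundary = boundary
  ; first    = refl
  }
  where
  module V = Widening (widen p)
  same : ∀ {n} (W S : Subset (suc n * 3)) → next (suc n) W ≡ next (suc n) S →
         (0F ∈ W → 0F ∈ S) × (1F ∈ W → 1F ∈ S) × (2F ∈ W → 2F ∈ S)
  same (_ ∷ _ ∷ _ ∷ _) (_ ∷ _ ∷ _ ∷ _) refl =
    (λ { here → here }) , (λ { (there here) → there here }) , λ { (there (there here)) → there (there here) }
  boundary : ∀ {f o} → f ∈ blank ++ V.W → o ∉ blank ++ V.W → Edge± (suc n) f o → f ∈ blank ++ S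
  boundary (there (there (there f∈))) o∉ (inj₁ (shift e)) =
    there (there (there (V.boundary f∈ (λ o∈ → o∉ (there (there (there o∈)))) (inj₁ e))))
  boundary (there (there (there f∈))) o∉ (inj₂ (shift e)) =
    there (there (there (V.boundary f∈ (λ o∈ → o∉ (there (there (there o∈)))) (inj₂ e))))
  -- Edges to the blank column meet `V.W` in its first column only, which by `V.first` is that of
  -- `S`.
  boundary (there (there (there f∈))) _ (inj₂ h₀) = there (there (there (proj₁ (same V.W S V.first) f∈)))
  boundary (there (there (there f∈))) _ (inj₂ h₁) = there (there (there (proj₁ (proj₂ (same V.W S V.first)) f∈)))
  boundary (there (there (there f∈))) _ (inj₂ h₂) = there (there (there (proj₂ (proj₂ (same V.W S V.first)) f∈)))

-- Necessity

module GridWalks {n} (D : Orientation (Grid n)) where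
  open Orientation D public
  open Walks D public
  open Decide (adj? n) public
  open Bipartite (colour n) (adj-flips {n}) public

  arc-irrefl : ∀ {u v} → Arc u v → u ≢ v
  arc-irrefl a refl = arc-asym a a

adj-open : ∀ {m x y} → Adj {3 + m} x y → Open (3 + m) x y
adj-open {m} a with adj⇒edge± (3 + m) a
... | inj₁ e = edge-open e
... | inj₂ e = open-sym (edge-open e)

module _ {m} (D : Orientation (Grid (3 + m))) (st : Walks.Strongly D) where
  open GridWalks D

  private
    all-closed : Closed ⊤
    all-closed _ _ _ = ∈⊤

    other : (x : Fin ((3 + m) * 3)) → ∃ λ y → x ≢ y
    other zero    = 1F , λ ()
    other (suc _) = 0F , λ ()

  hasOut : ∀ x → ∃ λ y → Arc x y
  hasOut x = let _ , x≢z = other x ; y , _ , a = outNeighbour st all-closed ∈⊤ ∈⊤ x≢z in y , a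

  hasIn : ∀ x → ∃ λ y → Arc y x
  hasIn x = let _ , x≢z = other x ; y , _ , a = inNeighbour st all-closed ∈⊤ ∈⊤ (x≢z ∘ sym) in y , a

  module _ {S} (cl : Closed S) where

    -- The arc is the middle of a path `u x y w` with nonadjacent ends. If `u` and `w` belong to `S`
    -- and both outer edges continue the arc, the path is a geodesic, which is impossible. If
    -- instead `x` points to `u`, an in-neighbour of `x` in `S` would put `x` on a geodesic of
    -- length two, so that in-neighbour is the third missing vertex. The case of `w` pointing to `y`
    -- is dual.
    gap-arc : ∀ {x y} → x ∉ S → y ∉ S → Arc x y → Outside₃ S
    gap-arc {x} {y} x∉ y∉ xy with adj-open (arc⇒adj xy)
    ... | u , w , ux , yw , u≢y , w≢x , ¬uw with u ∈? S | w ∈? S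
    ...   | no u∉ | _ = x , y , u , x∉ , y∉ , u∉ , arc-irrefl xy ∘ sym , irrefl , u≢y
      where
      irrefl : u ≢ x
      irrefl refl = Graph.adj-irrefl (Grid (3 + m)) u (edge±⇒adj ux)
    ...   | yes _ | no w∉ = x , y , w , x∉ , y∉ , w∉ , arc-irrefl xy ∘ sym , w≢x , irrefl
      where
      irrefl : w ≢ y
      irrefl refl = Graph.adj-irrefl (Grid (3 + m)) w (edge±⇒adj yw)
    ...   | yes u∈ | yes w∈ with adj⇒arc (edge±⇒adj ux) | adj⇒arc (edge±⇒adj yw)
    ...     | inj₁ u→x | inj₁ y→w =
      contradiction (cl u∈ w∈ (between₃ˡ u→x xy y→w (¬uw ∘ adj⇒edge± (3 + m) ∘ arc⇒adj))) x∉
    ...     | inj₂ x→u | _ with hasIn x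
    ...       | t , t→x with t ∈? S
    ...         | yes t∈ = contradiction (cl t∈ u∈ (between₂ t→x x→u)) x∉
    ...         | no t∉  = x , y , t , x∉ , y∉ , t∉ , arc-irrefl xy ∘ sym , arc-irrefl t→x , λ { refl → arc-asym xy t→x }
    gap-arc {x} {y} x∉ y∉ xy | u , w , ux , yw , u≢y , w≢x , ¬uw | yes u∈ | yes w∈ | inj₁ u→x | inj₂ w→y with hasOut y
    ... | t , y→t with t ∈? S
    ...   | yes t∈ = contradiction (cl w∈ t∈ (between₂ w→y y→t)) y∉
    ...   | no t∉  = x , y , t , x∉ , y∉ , t∉ , arc-irrefl xy ∘ sym , (λ { refl → arc-asym xy y→t }) , arc-irrefl y→t ∘ sym

    -- A missing vertex cannot have both an in-neighbour and an out-neighbour in `S`, so some arc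
    -- has both ends missing.
    gap : S ≢ ⊤ → Outside₃ S
    gap S≢⊤ with Fin.any? (λ x → ¬∈? x)
      where
      ¬∈? : ∀ x → Dec (x ∉ S)
      ¬∈? x = ¬? (x ∈? S)
    ... | no all∈ = contradiction (⊆-antisym (λ _ → ∈⊤) λ {x} _ → decidable-stable (x ∈? S) λ x∉ → all∈ (x , x∉)) S≢⊤
    ... | yes (x , x∉) with hasIn x | hasOut x
    ...   | u , u→x | w , x→w with u ∈? S | w ∈? S
    ...     | yes u∈ | yes w∈ = contradiction (cl u∈ w∈ (between₂ u→x x→w)) x∉
    ...     | no u∉  | _      = gap-arc u∉ x∉ u→x
    ...     | yes _  | no w∉  = gap-arc x∉ w∉ x→w

    twoNeighbours : 2 ≤ ∣ S ∣ → ∀ {v} → v ∈ S → TwoNeighbours (3 + m) S v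
    twoNeighbours big v∈ =
      let u , u∈ , u≢v  = another v∈ big
          x , x∈ , x→v = inNeighbour st cl u∈ v∈ u≢v
          y , y∈ , v→y = outNeighbour st cl v∈ u∈ (u≢v ∘ sym)
      in x , y , (λ x≡y → arc-asym x→v (subst (Arc _) (sym x≡y) v→y))
         , (x∈ , swap (adj⇒edge± (3 + m) (arc⇒adj x→v))) , (y∈ , adj⇒edge± (3 + m) (arc⇒adj v→y))

    sizes : 2 ≤ ∣ S ∣ → Nonempty S → Allowed (3 + m) S
    -- A blank column on the left supplies the context that `rich` expects.
    sizes big ne = classify (3 + m) S (rich (3 + m) tn) ne
      where
      tn : ∀ {v} → old v ∈ blank ++ S → TwoNeighbours (4 + m) (blank ++ S) (old v)
      tn (there (there (there v∈))) =
        let x , y , x≢y , (x∈ , vx) , (y∈ , vy) = twoNeighbours big v∈ in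
        old x , old y , x≢y ∘ old-injective
        , (there (there (there x∈)) , shift± vx) , (there (there (there y∈)) , shift± vy)

    -- The boundary of the widened set lies in `S`, so `closed-superset` applies.
    pinched-extends : Nonempty S → Pinched (3 + m) S → ∃ λ W → Convex D W × W ≢ ⊤ × ∣ S ∣ < ∣ W ∣
    pinched-extends (x , x∈) p =
      W , convex (x , S⊆W x∈) (closed-superset cl S⊆W bd)
        , (λ W≡⊤ → proj₂ proper (subst (proj₁ proper ∈_) (sym W≡⊤) ∈⊤)) , p⊂q⇒∣p∣<∣q∣ (S⊆W , grown)
      where
      open Widening (widen p)
      bd : ∀ {f} → Boundary W f → f ∈ S
      bd (f∈ , o , o∉ , inj₁ a) = boundary f∈ o∉ (adj⇒edge± (3 + m) (arc⇒adj a))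
      bd (f∈ , o , o∉ , inj₂ a) = boundary f∈ o∉ (swap (adj⇒edge± (3 + m) (arc⇒adj a)))

only-seven : ∀ {s} {A : Set} → s List.∈ 2 ∷ 3 ∷ 5 ∷ 7 ∷ [] → T (s ≡ᵇ 4) ⊎ T (s ≡ᵇ 6) ⊎ (s ≡ 7 × A) ⊎ 8 ≤ s → s ≡ 7 × A
only-seven _ (inj₂ (inj₂ (inj₁ seven))) = seven
only-seven (here refl) (inj₁ ())
only-seven (here refl) (inj₂ (inj₁ ()))
only-seven (there (here refl)) (inj₁ ())
only-seven (there (here refl)) (inj₂ (inj₁ ()))
only-seven (there (there (here refl))) (inj₁ ())
only-seven (there (there (here refl))) (inj₂ (inj₁ ()))
only-seven (there (there (there (here refl)))) (inj₁ ())
only-seven (there (there (there (here refl)))) (inj₂ (inj₁ ()))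
only-seven (here refl) (inj₂ (inj₂ (inj₂ (s≤s (s≤s ())))))
only-seven (there (here refl)) (inj₂ (inj₂ (inj₂ (s≤s (s≤s (s≤s ()))))))
only-seven (there (there (here refl))) (inj₂ (inj₂ (inj₂ (s≤s (s≤s (s≤s (s≤s (s≤s ()))))))))
only-seven (there (there (there (here refl)))) (inj₂ (inj₂ (inj₂ (s≤s (s≤s (s≤s (s≤s (s≤s (s≤s (s≤s ()))))))))))

excluded≥2 : ∀ {s} → s List.∈ 2 ∷ 3 ∷ 5 ∷ 7 ∷ [] → 2 ≤ s
excluded≥2 (here refl) = s≤s (s≤s z≤n)
excluded≥2 (there (here refl)) = s≤s (s≤s z≤n)
excluded≥2 (there (there (here refl))) = s≤s (s≤s z≤n)
excluded≥2 (there (there (there (here refl)))) = s≤s (s≤s z≤n)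

necessary : ∀ m {r} → StrongConvexitySpectrum (P (3 + m) □ P 3) r →
            (1 ≤ r × r ≤ 3 * (3 + m) ∸ 3) × ¬ r List.∈ 2 ∷ 3 ∷ 5 ∷ 7 ∷ []
necessary m {r} (D , strong , (S , conv@(ne , _) , S≢⊤ , refl) , largest) =
  (positive ne , bounded) , excluded
  where
  open GridWalks D
  st = strong⇒strongly strong
  cl = convex⇒closed conv

  positive : ∀ {k} {S : Subset k} → Nonempty S → 1 ≤ ∣ S ∣
  positive (x , x∈) = ℕ.≤-trans (s≤s z≤n) (x∈p⇒∣p-x∣<∣p∣ x∈)

  bounded : ∣ S ∣ ≤ 3 * (3 + m) ∸ 3
  bounded = subst (∣ S ∣ ≤_) (cong (_∸ 3) (ℕ.*-comm (3 + m) 3))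
              (ℕ.∸-monoˡ-≤ 3 (outside₃-size (gap D st cl S≢⊤)))

  excluded : ¬ ∣ S ∣ List.∈ 2 ∷ 3 ∷ 5 ∷ 7 ∷ []
  -- Of the four sizes only seven survives the classification, and then the set is pinched and not
  -- largest.
  excluded ex with only-seven ex (sizes D st cl (excluded≥2 ex) ne)
  ... | s≡7 , p with pinched-extends D st cl ne p
  ...   | W , convW , W≢⊤ , S<W = ℕ.<⇒≱ S<W (largest W convW W≢⊤)

-- Checking small orientations

T⇒≡ : ∀ {b} → T b → b ≡ true
T⇒≡ {true} _ = refl

Digraph : ℕ → Set
Digraph N = Fin N → Fin N → Bool

record Orients n (dir : Digraph (n * 3)) : Set where
  field
    onEdges  : ∀ {u v} → T (dir u v) → Edge± n u v
    opposed  : ∀ {u v} → Edge n u v → dir v u ≡ not (dir u v)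

  orientation : Orientation (Grid n)
  orientation = record
    { Arc      = λ u v → T (dir u v)
    ; arc⇒adj  = edge±⇒adj ∘ onEdges
    ; adj⇒arc  = λ a → [ one , swap ∘ one ]′ (adj⇒edge± n a)
    ; arc-asym = λ uv vu → clash uv vu (onEdges uv)
    }
    where
    one : ∀ {u v} → Edge n u v → T (dir u v) ⊎ T (dir v u)
    one {u} {v} e rewrite opposed e with dir u v
    ... | true  = inj₁ tt
    ... | false = inj₂ tt
    never : ∀ {u v} → T (dir u v) → T (dir v u) → ¬ Edge n u v
    never {u} {v} uv vu e with dir u v | dir v u | opposed e
    ... | true | true | ()
    clash : ∀ {u v} → T (dir u v) → T (dir v u) → ¬ Edge± n u v
    clash uv vu (inj₁ e) = never uv vu e
    clash uv vu (inj₂ e) = never vu uv e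

-- The two vertical edges of a column, then the three edges from it to the next column (void for the last one).
Arrows : Set
Arrows = Vec Bool 5

pattern ↓ = true
pattern ↑ = false
pattern ▸ = true
pattern ◂ = false

is : ∀ {N} → ℕ → Fin N → Bool
is k v = toℕ v ≡ᵇ k

-- Among the pairs that join row `k` of the new column to old vertices, the factor `is k v` selects
-- the horizontal edge.
addColumn : ∀ {N} → Arrows → Digraph N → Digraph (3 + N)
addColumn (p ∷ _ ∷ _) dir 0F 1F = p
addColumn (p ∷ _ ∷ _) dir 1F 0F = not p
addColumn (_ ∷ q ∷ _) dir 1F 2F = q
addColumn (_ ∷ q ∷ _) dir 2F 1F = not q
addColumn (_ ∷ _ ∷ x ∷ _) dir 0F (old v) = is 0 v ∧ x
addColumn (_ ∷ _ ∷ x ∷ _) dir (old v) 0F = is 0 v ∧ not x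
addColumn (_ ∷ _ ∷ _ ∷ y ∷ _) dir 1F (old v) = is 1 v ∧ y
addColumn (_ ∷ _ ∷ _ ∷ y ∷ _) dir (old v) 1F = is 1 v ∧ not y
addColumn (_ ∷ _ ∷ _ ∷ _ ∷ z ∷ _) dir 2F (old v) = is 2 v ∧ z
addColumn (_ ∷ _ ∷ _ ∷ _ ∷ z ∷ _) dir (old v) 2F = is 2 v ∧ not z
addColumn _ dir (old u) (old v) = dir u v
addColumn _ dir _ _ = false

orients-add : ∀ {dir} a → Orients n dir → Orients (suc n) (addColumn a dir)
orients-add {n} {dir} a@(_ ∷ _ ∷ _ ∷ _ ∷ _ ∷ []) o = record
  { onEdges = λ {u} {v} → edges n u v (Orients.onEdges o) ; opposed = opp }
  where
  edges : ∀ n {dir : Digraph (n * 3)} u v → (∀ {u v} → T (dir u v) → Edge± n u v) →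
          T (addColumn a dir u v) → Edge± (suc n) u v
  edges n 0F 1F _ _ = inj₁ v₀
  edges n 1F 0F _ _ = inj₂ v₀
  edges n 1F 2F _ _ = inj₁ v₁
  edges n 2F 1F _ _ = inj₂ v₁
  edges (suc n) 0F 3F _ _ = inj₁ h₀
  edges (suc n) 3F 0F _ _ = inj₂ h₀
  edges (suc n) 1F 4F _ _ = inj₁ h₁
  edges (suc n) 4F 1F _ _ = inj₂ h₁
  edges (suc n) 2F 5F _ _ = inj₁ h₂
  edges (suc n) 5F 2F _ _ = inj₂ h₂
  edges n (old u) (old v) f t = shift± (f t)
  opp : ∀ {u v} → Edge (suc n) u v → addColumn a dir v u ≡ not (addColumn a dir u v)
  opp v₀ = refl
  opp v₁ = refl
  opp h₀ = refl
  opp h₁ = refl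
  opp h₂ = refl
  opp (shift e) = Orients.opposed o e

grid : Vec Arrows n → Digraph (n * 3)
grid []       = λ ()
grid (a ∷ as) = addColumn a (grid as)

orients-grid : (as : Vec Arrows n) → Orients n (grid as)
orients-grid []       = record { onEdges = λ { {()} } ; opposed = λ () }
orients-grid (a ∷ as) = orients-add a (orients-grid as)

_==_ : ∀ {N} → Fin N → Fin N → Bool
u == v = toℕ u ≡ᵇ toℕ v

every : ∀ {N} → (Fin N → Bool) → Bool
every {zero}  f = true
every {suc N} f = f zero ∧ every (f ∘ suc)

every-sound : ∀ {N} {f : Fin N → Bool} → T (every f) → ∀ i → T (f i)
every-sound t zero    = proj₁ (Equivalence.to T-∧ t)
every-sound {f = f} t (suc i) = every-sound (proj₂ (Equivalence.to (T-∧ {f zero}) t)) i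

mem : ∀ {N} → Fin N → List (Fin N) → Bool
mem u = any (u ==_)

isKnown : ∀ {N} → List (Fin N × Fin N) → Fin N × Fin N → Bool
isKnown known (u , v) = any (λ (x , y) → ((x == u) ∧ (y == v)) ∨ ((x == v) ∧ (y == u))) known

Table : ℕ → Set
Table N = Vec (Vec ℕ N) N

module _ {N} (dir : Digraph N) where

  outs : Vec (List (Fin N)) N
  outs = tabulate λ u → List.filterᵇ (dir u) (List.allFin N)

  relax : Vec (List (Fin N)) N → Table N → Table N
  relax os t = Vec.zipWith (λ o row → List.foldr (λ w r → Vec.zipWith (λ x y → x ⊓ suc y) r (lookup t w)) row o) os t

  -- Relaxation in `N` rounds, as in the Bellman-Ford algorithm. The value `N` stands for infinity,
  -- because finite distances stay below `N`. The resulting table is certified by `correct`.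
  distances : Table N
  distances = go N (tabulate λ u → tabulate λ v → if u == v then 0 else N)
    where
    go : ℕ → Table N → Table N
    go zero    t = t
    go (suc k) t = go k (relax outs t)

  module _ (t : Table N) where

    dist : Fin N → Fin N → ℕ
    dist u v = lookup (lookup t u) v

    btw : Fin N → Fin N → Fin N → Bool
    btw u v w = (dist u w + dist w v) ≤ᵇ dist u v

    -- Holds exactly when t is the table of distances of a strong digraph.
    correct : Bool
    correct = every (λ u → dist u u ≡ᵇ 0)
            ∧ every (λ u → every λ v → (u == v) ∨ any (λ w → dir u w ∧ (suc (dist w v) ≡ᵇ dist u v)) (List.allFin N))
            ∧ every (λ u → every λ w → dir u w ⇒ᵇ every λ v → dist u v ≤ᵇ suc (dist w v))

    closedᵇ : Subset N → Bool
    closedᵇ S = every λ u → lookup S u ⇒ᵇ every λ v → lookup S v ⇒ᵇ every λ w → btw u v w ⇒ᵇ lookup S w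

    grow : List (Fin N) → List (Fin N)
    grow K = List.filterᵇ (λ w → not (mem w K) ∧ any (λ u → any (λ v → btw u v w) K) K) (List.allFin N)

    mutual
      -- `K` is closed under geodesics round by round until it contains a pair known to generate
      -- everything, or all vertices. Each round adds a vertex, so `N` rounds of fuel suffice;
      -- getting stuck yields `false`.
      spans : ℕ → List (Fin N × Fin N) → List (Fin N) → Bool
      spans zero    _     _ = false
      spans (suc k) known K = any (λ (x , y) → mem x K ∧ mem y K) known ∨ every (λ w → mem w K) ∨ extend k known K (grow K)

      extend : ℕ → List (Fin N × Fin N) → List (Fin N) → List (Fin N) → Bool
      extend _ _     _ []          = false
      extend k known K new@(_ ∷ _) = spans k known (K List.++ new)

    -- The arcs that generate all vertices.
    collect : List (Fin N × Fin N) → List (Fin N × Fin N) → List (Fin N × Fin N)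
    collect known []             = known
    collect known ((u , v) ∷ es) = if spans N known (u ∷ v ∷ []) then collect ((u , v) ∷ known) es else collect known es

    arcs : Subset N → Subset N → List (Fin N × Fin N)
    arcs A B = List.concatMap (λ u → List.map (u ,_) (List.filterᵇ (λ v → dir u v ∧
      not ((lookup A u ∧ lookup A v) ∨ (lookup B u ∧ lookup B v))) (List.allFin N))) (List.allFin N)

    -- Two vertices of a proper closed set then lie in A together or in B together.
    separated : Subset N → Subset N → List (Fin N × Fin N) → Bool
    separated A B known = every λ u → every λ v → (toℕ v ≤ᵇ toℕ u) ∨
      (lookup A u ∧ lookup A v) ∨ (lookup B u ∧ lookup B v) ∨
      any (λ (x , y) → (btw u v x ∨ btw v u x) ∧ (btw u v y ∨ btw v u y)) known

    certified : Subset N → Subset N → List (Fin N × Fin N) → List (Fin N × Fin N) → Bool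
    certified A B required known = separated A B known ∧ all (isKnown known) required

    -- `A` is the candidate for the largest proper closed set, `B` a second region that may contain
    -- closed sets, and `required` lists pairs that have to generate everything.
    valid : Subset N → Subset N → List (Fin N × Fin N) → Bool
    valid A B required = correct ∧ closedᵇ A ∧ certified A B required (collect [] (arcs A B))

  check : Subset N → Subset N → List (Fin N × Fin N) → Bool
  check = valid distances

-- Soundness of the check

∧ˡ : ∀ a {b} → T (a ∧ b) → T a
∧ˡ true _ = _

∧ʳ : ∀ a {b} → T (a ∧ b) → T b
∧ʳ true t = t

∨-case : ∀ a {b} → T (a ∨ b) → T a ⊎ T b
∨-case true  _ = inj₁ _
∨-case false t = inj₂ t

==⇒≡ : ∀ {N} {u v : Fin N} → T (u == v) → u ≡ v
==⇒≡ t = Fin.toℕ-injective (ℕ.≡ᵇ⇒≡ _ _ t)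

any-elim : ∀ {A : Set} {P : A → Set} {Q : Set} f xs → All P xs → (∀ x → P x → T (f x) → Q) → T (any f xs) → Q
any-elim f (x ∷ xs) (px ∷ pxs) k t with ∨-case (f x) t
... | inj₁ fx = k x px fx
... | inj₂ t′ = any-elim f xs pxs k t′

all-true : ∀ {A : Set} (xs : List A) → All (λ _ → T true) xs
all-true xs = All.universal (λ _ → _) xs

∈⇒T : ∀ {N} {S : Subset N} {u} → u ∈ S → T (lookup S u)
∈⇒T u∈ = Equivalence.from T-≡ ([]=⇒lookup u∈)

T⇒∈ : ∀ {N} {S : Subset N} {u} → T (lookup S u) → u ∈ S
T⇒∈ {S = S} {u} t = lookup⇒[]= u S (T⇒≡ t)

Full : ∀ {N} → Subset N → Set
Full S = ∀ x → x ∈ S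

record Seed n (dir : Digraph (n * 3)) (r : ℕ) : Set where
  field
    orients : Orients n dir
  open GridWalks (Orients.orientation orients) public
  field
    strongly : Strongly
    S        : Subset (n * 3)
    closed   : Closed S
    proper   : S ≢ ⊤
    nonempty : Nonempty S
    size     : ∣ S ∣ ≡ r
    largest  : ∀ R → Closed R → R ≢ ⊤ → ∣ R ∣ ≤ r

full⇒⊤ : ∀ {N} {S : Subset N} → Full S → S ≡ ⊤
full⇒⊤ f = ⊆-antisym (λ _ → ∈⊤) λ {x} _ → f x

seed⇒spectrum : ∀ {n dir r} → Seed n dir r → StrongConvexitySpectrum (Grid n) r
seed⇒spectrum s = Orients.orientation orients , strongly⇒strong strongly
  , (S , convex nonempty closed , proper , size) , λ R conv → largest R (convex⇒closed conv)
  where open Seed s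

size-nonempty : ∀ {N} {S : Subset N} → 1 ≤ ∣ S ∣ → Nonempty S
size-nonempty {N} {S} 1≤S with nonempty? S
... | yes ne = ne
... | no ¬ne with Empty-unique ¬ne
...   | refl = contradiction 1≤S (ℕ.<⇒≱ (s≤s (ℕ.≤-reflexive (∣⊥∣≡0 N))))

module Sound {n} {dir : Digraph (n * 3)} (o : Orients n dir) (t : Table (n * 3)) (ok : T (correct dir t)) where
  open GridWalks (Orients.orientation o)

  private
    d = dist dir t

    zeros : Bool
    zeros = every {n * 3} λ u → d u u ≡ᵇ 0

    down : Fin (n * 3) → Fin (n * 3) → Bool
    down u v = (u == v) ∨ any (λ w → dir u w ∧ (suc (d w v) ≡ᵇ d u v)) (List.allFin (n * 3))

    rest : T (every (λ u → every (down u)) ∧ every (λ u → every λ w → dir u w ⇒ᵇ every λ v → d u v ≤ᵇ suc (d w v)))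
    rest = ∧ʳ zeros ok

    dist-refl : ∀ u → d u u ≡ 0
    dist-refl u = ℕ.≡ᵇ⇒≡ _ _ (every-sound (∧ˡ zeros ok) u)

    descend : ∀ {u v} → u ≢ v → ∃ λ w → T (dir u w) × suc (d w v) ≡ d u v
    descend {u} {v} u≢v with ∨-case (u == v) (every-sound (every-sound (∧ˡ (every (λ u → every (down u))) rest) u) v)
    ... | inj₁ u≡v = contradiction (==⇒≡ u≡v) u≢v
    ... | inj₂ a   = any-elim (λ w → dir u w ∧ (suc (d w v) ≡ᵇ d u v)) (List.allFin (n * 3)) (all-true _)
      (λ w _ tw → w , ∧ˡ (dir u w) tw , ℕ.≡ᵇ⇒≡ _ _ (∧ʳ (dir u w) tw)) a

    lipschitz : ∀ {u w} v → T (dir u w) → d u v ≤ suc (d w v)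
    lipschitz {u} {w} v uw = ℕ.≤ᵇ⇒≤ _ _
      (every-sound (⇒ᵇ-elim {dir u w} (every-sound (every-sound (∧ʳ (every (λ u → every (down u))) rest) u) w) uw) v)

  -- By the last condition in `correct`, the tabulated distance to `v` drops by at most one along an
  -- arc.
  dist-minimal : ∀ {u v m} → Walk u v m → d u v ≤ m
  dist-minimal {u} nil = ℕ.≤-reflexive (dist-refl u)
  dist-minimal {v = v} (cons a p) = ℕ.≤-trans (lipschitz v a) (s≤s (dist-minimal p))

  -- By the second condition in `correct`, some arc lowers the distance by one; following such arcs
  -- leads to `v`.
  dist-walk : ∀ k {u v} → d u v ≡ k → Walk u v k
  dist-walk k {u} {v} eq with u Fin.≟ v
  dist-walk k eq | yes refl with trans (sym eq) (dist-refl _)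
  ... | refl = nil
  dist-walk k eq | no u≢v with descend u≢v
  dist-walk zero    eq | no _ | w , uw , wv with () ← trans wv eq
  dist-walk (suc k) eq | no _ | w , uw , wv = cons uw (dist-walk k (ℕ.suc-injective (trans wv eq)))

  strongly : Strongly
  strongly u v = d u v , dist-walk _ refl

  btw-sound : ∀ {u v w} → T (btw dir t u v w) → Between u v w
  btw-sound b = _ , _ , dist-walk _ refl , dist-walk _ refl ,
    λ p → ℕ.≤-trans (ℕ.≤ᵇ⇒≤ _ _ b) (dist-minimal p)

  btw-complete : ∀ {u v w} → Between u v w → T (btw dir t u v w)
  btw-complete (a , b , p , q , short) =
    ℕ.≤⇒≤ᵇ (ℕ.≤-trans (ℕ.+-mono-≤ (dist-minimal p) (dist-minimal q)) (short (dist-walk _ refl)))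

  closed-sound : ∀ {S} → T (closedᵇ dir t S) → Closed S
  closed-sound {S} c {u} {v} {w} u∈ v∈ b = T⇒∈ {S = S} (⇒ᵇ-elim {btw dir t u v w}
    (every-sound (⇒ᵇ-elim {lookup S v} (every-sound (⇒ᵇ-elim {lookup S u} (every-sound c u) (∈⇒T u∈)) v) (∈⇒T v∈)) w)
    (btw-complete b))

  module _ {R} (cl : Closed R) where

    Forcing : Fin (n * 3) × Fin (n * 3) → Set
    Forcing (u , v) = u ∈ R → v ∈ R → Full R

    mem-sound : ∀ {x} K → All (_∈ R) K → T (mem x K) → x ∈ R
    mem-sound {x} K K⊆ m = any-elim (x ==_) K K⊆ (λ y y∈ x==y → subst (_∈ R) (sym (==⇒≡ x==y)) y∈) m

    grow-sound : ∀ K → All (_∈ R) K → All (_∈ R) (grow dir t K)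
    grow-sound K K⊆ = go (List.allFin (n * 3))
      where
      go : ∀ ws → All (_∈ R) (List.filterᵇ (λ w → not (mem w K) ∧ any (λ u → any (λ v → btw dir t u v w) K) K) ws)
      go [] = []
      go (w ∷ ws) with not (mem w K) ∧ any (λ u → any (λ v → btw dir t u v w) K) K in eq
      ... | false = go ws
      ... | true  = any-elim (λ u → any (λ v → btw dir t u v w) K) K K⊆ (λ u u∈ → any-elim (λ v → btw dir t u v w) K K⊆ λ v v∈ b → cl u∈ v∈ (btw-sound b))
                      (∧ʳ (not (mem w K)) (Equivalence.from T-≡ eq)) ∷ go ws

    -- The invariant is that `K` stays inside the closed set `R`.
    spans-sound : ∀ k known K → All Forcing known → All (_∈ R) K → T (spans dir t k known K) → Full R
    spans-sound (suc k) known K fs K⊆ s with ∨-case (any (λ (x , y) → mem x K ∧ mem y K) known) s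
    ... | inj₁ hit = any-elim (λ (x , y) → mem x K ∧ mem y K) known fs (λ (x , y) f h →
      f (mem-sound K K⊆ (∧ˡ (mem x K) h)) (mem-sound K K⊆ (∧ʳ (mem x K) h))) hit
    ... | inj₂ s′ with ∨-case (every λ w → mem w K) s′
    ...   | inj₁ every = λ w → mem-sound K K⊆ (every-sound every w)
    ...   | inj₂ s″ with grow dir t K | grow-sound K K⊆
    ...     | new@(_ ∷ _) | new⊆ = spans-sound k known (K List.++ new) fs (All.++⁺ K⊆ new⊆) s″

    collect-sound : ∀ known es → All Forcing known → All Forcing (collect dir t known es)
    collect-sound known [] fs = fs
    collect-sound known ((u , v) ∷ es) fs with spans dir t (n * 3) known (u ∷ v ∷ []) in eq
    ... | false = collect-sound known es fs
    ... | true  = collect-sound _ es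
      ((λ u∈ v∈ → spans-sound (n * 3) known _ fs (u∈ ∷ v∈ ∷ []) (Equivalence.from T-≡ eq)) ∷ fs)

    known-sound : ∀ known {e} → All Forcing known → T (isKnown known e) → Forcing e
    known-sound known {u , v} fs k u∈ v∈ = any-elim (λ (x , y) → ((x == u) ∧ (y == v)) ∨ ((x == v) ∧ (y == u))) known fs pick k
      where
      pick : ∀ e → Forcing e → T (((proj₁ e == u) ∧ (proj₂ e == v)) ∨ ((proj₁ e == v) ∧ (proj₂ e == u))) → Full R
      pick (x , y) f m with ∨-case ((x == u) ∧ (y == v)) m
      ... | inj₁ h = f (subst (_∈ R) (sym (==⇒≡ (∧ˡ (x == u) h))) u∈) (subst (_∈ R) (sym (==⇒≡ (∧ʳ (x == u) h))) v∈)
      ... | inj₂ h = f (subst (_∈ R) (sym (==⇒≡ (∧ˡ (x == v) h))) v∈) (subst (_∈ R) (sym (==⇒≡ (∧ʳ (x == v) h))) u∈)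

    module _ (A B : Subset (n * 3)) known (fs : All Forcing known) (sep : T (separated dir t A B known)) (¬full : ¬ Full R) where

      private
        ordered : ∀ {u v} → toℕ u < toℕ v → u ∈ R → v ∈ R → (u ∈ A × v ∈ A) ⊎ (u ∈ B × v ∈ B)
        ordered {u} {v} u<v u∈ v∈ with ∨-case (toℕ v ≤ᵇ toℕ u) (every-sound (every-sound sep u) v)
        ... | inj₁ v≤u = contradiction (ℕ.≤ᵇ⇒≤ _ _ v≤u) (ℕ.<⇒≱ u<v)
        ... | inj₂ s with ∨-case (lookup A u ∧ lookup A v) s
        ...   | inj₁ a = inj₁ (T⇒∈ {S = A} (∧ˡ (lookup A u) a) , T⇒∈ {S = A} (∧ʳ (lookup A u) a))
        ...   | inj₂ s′ with ∨-case (lookup B u ∧ lookup B v) s′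
        ...     | inj₁ b = inj₂ (T⇒∈ {S = B} (∧ˡ (lookup B u) b) , T⇒∈ {S = B} (∧ʳ (lookup B u) b))
        ...     | inj₂ k = contradiction (any-elim
                    (λ (x , y) → (btw dir t u v x ∨ btw dir t v u x) ∧ (btw dir t u v y ∨ btw dir t v u y)) known fs
                    (λ (x , y) f h → f (on x (∧ˡ (btw dir t u v x ∨ btw dir t v u x) h)) (on y (∧ʳ (btw dir t u v x ∨ btw dir t v u x) h))) k) ¬full
          where
          on : ∀ x → T (btw dir t u v x ∨ btw dir t v u x) → x ∈ R
          on x h with ∨-case (btw dir t u v x) h
          ... | inj₁ b = cl u∈ v∈ (btw-sound b)
          ... | inj₂ b = cl v∈ u∈ (btw-sound b)

        together : ∀ {u v} → u ∈ R → v ∈ R → u ≢ v → (u ∈ A × v ∈ A) ⊎ (u ∈ B × v ∈ B)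
        together {u} {v} u∈ v∈ u≢v with ℕ.<-cmp (toℕ u) (toℕ v)
        ... | tri< u<v _ _ = ordered u<v u∈ v∈
        ... | tri≈ _ eq _ = contradiction (Fin.toℕ-injective eq) u≢v
        ... | tri> _ _ v<u with ordered v<u v∈ u∈
        ...   | inj₁ (a , b) = inj₁ (b , a)
        ...   | inj₂ (a , b) = inj₂ (b , a)

      -- If `R` has a member `a` outside `A`, every other member shares `B` with `a`. Thus `R` lies
      -- in `A`, lies in `B`, or is a single vertex.
      separated-size : ∀ {r} → 1 ≤ r → ∣ A ∣ ≤ r → ∣ B ∣ ≤ r → ∣ R ∣ ≤ r
      separated-size 1≤r A≤r B≤r with Fin.any? (λ u → (u ∈? R) ×-dec ¬? (u ∈? A))
      ... | no none = ℕ.≤-trans (p⊆q⇒∣p∣≤∣q∣ λ {u} u∈ → decidable-stable (u ∈? A) λ u∉ → none (u , u∈ , u∉)) A≤r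
      ... | yes (a , a∈ , a∉A) with a ∈? B
      ...   | yes a∈B = ℕ.≤-trans (p⊆q⇒∣p∣≤∣q∣ R⊆B) B≤r
        where
        R⊆B : R ⊆ B
        R⊆B {v} v∈ with a Fin.≟ v
        ... | yes refl = a∈B
        ... | no a≢v with together a∈ v∈ a≢v
        ...   | inj₁ (a∈A , _) = contradiction a∈A a∉A
        ...   | inj₂ (_ , v∈B) = v∈B
      ...   | no a∉B = ℕ.≤-trans (p⊆q⇒∣p∣≤∣q∣ R⊆a) (ℕ.≤-trans (ℕ.≤-reflexive (∣⁅x⁆∣≡1 a)) 1≤r)
        where
        R⊆a : R ⊆ ⁅ a ⁆
        R⊆a {v} v∈ with a Fin.≟ v
        ... | yes refl = x∈⁅x⁆ a
        ... | no a≢v with together a∈ v∈ a≢v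
        ...   | inj₁ (a∈A , _) = contradiction a∈A a∉A
        ...   | inj₂ (a∈B , _) = contradiction a∈B a∉B

module _ {n} (as : Vec Arrows n) (A B : Subset (n * 3)) (required : List (Fin (n * 3) × Fin (n * 3)))
         (c : T (check (grid as) A B required)) where

  private
    dir = grid as
    t   = distances dir
    o   = orients-grid as
    ok  = ∧ˡ (correct dir t) c
    c′  = ∧ʳ (correct dir t) c
    c″  = ∧ʳ (closedᵇ dir t A) c′
    known = collect dir t [] (arcs dir t A B)

  open Sound o t ok
  open GridWalks (Orients.orientation o) hiding (strongly⇒strong)

  checked-seed : ∀ {r} → A ≢ ⊤ → ∣ A ∣ ≡ r → 1 ≤ r → ∣ B ∣ ≤ r → Seed n dir r
  checked-seed A≢⊤ A≡r 1≤r B≤r = record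
    { orients  = o
    ; strongly = strongly
    ; S        = A
    ; closed   = closed-sound (∧ˡ (closedᵇ dir t A) c′)
    ; proper   = A≢⊤
    ; nonempty = size-nonempty (subst (1 ≤_) (sym A≡r) 1≤r)
    ; size     = A≡r
    ; largest  = λ R cl R≢⊤ → separated-size cl A B known (collect-sound cl [] (arcs dir t A B) [])
                   (∧ˡ (separated dir t A B known) c″) (R≢⊤ ∘ full⇒⊤) 1≤r (ℕ.≤-reflexive A≡r) B≤r
    }

  checked-forcing : ∀ {R} → Closed R → All (λ (u , v) → u ∈ R → v ∈ R → Full R) required
  checked-forcing cl = All.map (λ {e} → known-sound cl known {e} (collect-sound cl [] (arcs dir t A B) []))
    (All.all⁺ (isKnown known) required (∧ʳ (separated dir t A B known) c″))

-- Prepending a column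

along : ∀ {N} → Bool → Digraph N → Fin N → Fin N → Set
along true  dir u v = T (dir u v)
along false dir u v = T (dir v u)

-- The columns f 0, f 1, f 2 and f 3, f 4, f 5 are adjacent, and p tells in which direction the squares turn.
Squares : ∀ {N} → Bool → (Fin (6 + n) → Fin N) → Digraph N → Set
Squares p f dir = (f 0F ⟶ f 3F) × (f 3F ⟶ f 4F) × (f 4F ⟶ f 1F) × (f 1F ⟶ f 0F)
                × (f 1F ⟶ f 2F) × (f 2F ⟶ f 5F) × (f 5F ⟶ f 4F)
  where _⟶_ = along p dir

Near : Bool → Digraph ((2 + n) * 3) → Set
Near {n} p = Squares {n * 3} p λ v → v

-- The new squares turn opposite to the old ones beside them. The two vertical arcs of the new
-- column both enter its centre or both leave it.
newArrows : Bool → Arrows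
newArrows p = p ∷ not p ∷ not p ∷ p ∷ not p ∷ []

prepend : Bool → Digraph ((2 + n) * 3) → Digraph ((3 + n) * 3)
prepend p = addColumn (newArrows p)

near-prepend : ∀ p {dir : Digraph ((2 + n) * 3)} → Near {n} p dir → Near {suc n} (not p) (prepend {n} p dir)
near-prepend true  (_ , _ , _ , a , b , _ , _) = _ , a , _ , _ , _ , _ , b
near-prepend false (_ , _ , _ , a , b , _ , _) = _ , a , _ , _ , _ , _ , b

module SquareRules {n} {dir : Digraph ((2 + n) * 3)} (o : Orients (2 + n) dir) where
  open GridWalks (Orients.orientation o)

  -- `4F` lies on both squares, and after a prepending it is an old vertex. Walks to and from it
  -- keep the extended orientation strong.
  hub : ∀ p → Near {n} p dir → (j : Fin 3) → let u = j ↑ˡ (3 + n * 3) in ∃ (Walk u 4F) × ∃ (Walk 4F u)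
  hub true  (a , b , c , d , e , f , g) 0F = (_ , cons a (cons b nil)) , (_ , cons c (cons d nil))
  hub true  (a , b , c , d , e , f , g) 1F = (_ , cons d (cons a (cons b nil))) , (_ , cons c nil)
  hub true  (a , b , c , d , e , f , g) 2F = (_ , cons f (cons g nil)) , (_ , cons c (cons e nil))
  hub false (a , b , c , d , e , f , g) 0F = (_ , cons d (cons c nil)) , (_ , cons b (cons a nil))
  hub false (a , b , c , d , e , f , g) 1F = (_ , cons c nil) , (_ , cons b (cons a (cons d nil)))
  hub false (a , b , c , d , e , f , g) 2F = (_ , cons e (cons c nil)) , (_ , cons g (cons f nil))

  module _ {R} (cl : Closed R) where

    -- This rule and the next four apply `square` to one arc of a directed square. Vertical edges
    -- pass membership on to the next column and back.
    top-inward : ∀ p → Near {n} p dir → 0F ∈ R → 1F ∈ R → 3F ∈ R × 4F ∈ R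
    top-inward true  (a , b , c , d , _) x∈ y∈ = let z∈ , w∈ = square cl d a b c y∈ x∈ in z∈ , w∈
    top-inward false (a , b , c , d , _) x∈ y∈ = let z∈ , w∈ = square cl d c b a x∈ y∈ in w∈ , z∈

    top-outward : ∀ p → Near {n} p dir → 3F ∈ R → 4F ∈ R → 0F ∈ R × 1F ∈ R
    top-outward true  (a , b , c , d , _) x∈ y∈ = let z∈ , w∈ = square cl b c d a x∈ y∈ in w∈ , z∈
    top-outward false (a , b , c , d , _) x∈ y∈ = let z∈ , w∈ = square cl b a d c y∈ x∈ in z∈ , w∈

    bottom-inward : ∀ p → Near {n} p dir → 2F ∈ R → 1F ∈ R → 5F ∈ R × 4F ∈ R
    bottom-inward true  (_ , _ , c , _ , e , f , g) x∈ y∈ = let z∈ , w∈ = square cl e f g c y∈ x∈ in z∈ , w∈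
    bottom-inward false (_ , _ , c , _ , e , f , g) x∈ y∈ = let z∈ , w∈ = square cl e c g f x∈ y∈ in w∈ , z∈

    bottom-outward : ∀ p → Near {n} p dir → 5F ∈ R → 4F ∈ R → 2F ∈ R × 1F ∈ R
    bottom-outward true  (_ , _ , c , _ , e , f , g) x∈ y∈ = let z∈ , w∈ = square cl g c e f x∈ y∈ in w∈ , z∈
    bottom-outward false (_ , _ , c , _ , e , f , g) x∈ y∈ = let z∈ , w∈ = square cl g f e c y∈ x∈ in z∈ , w∈

    middle : ∀ p → Near {n} p dir → 1F ∈ R → 4F ∈ R → 0F ∈ R × 3F ∈ R
    middle true  (a , b , c , d , _) x∈ y∈ = square cl c d a b y∈ x∈
    middle false (a , b , c , d , _) x∈ y∈ = let z∈ , w∈ = square cl c b a d x∈ y∈ in w∈ , z∈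

-- This is the reflection in the first old column, restricted to the new column.
fold : ∀ {m} → Fin (9 + m) → Fin (6 + m)
fold 0F      = 3F
fold 1F      = 4F
fold 2F      = 5F
fold (old u) = u

module Extension {n p} {dir : Digraph ((2 + n) * 3)} (o : Orients (2 + n) dir) (near : Near {n} p dir)
                 (st : Walks.Strongly (Orients.orientation o)) where

  o⁺ : Orients (3 + n) (prepend {n} p dir)
  o⁺ = orients-add (newArrows p) o

  near⁺ : Near {suc n} (not p) (prepend {n} p dir)
  near⁺ = near-prepend {n} p near

  module Old = GridWalks (Orients.orientation o)
  module New = GridWalks (Orients.orientation o⁺)
  open Old using (nil; cons)
  open SquareRules o⁺

  adjacent : ∀ u v → T (prepend {n} p dir u v) ⊎ T (prepend {n} p dir v u) → Edge± (3 + n) u v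
  adjacent u v (inj₁ a) = Orients.onEdges o⁺ {u} {v} a
  adjacent u v (inj₂ a) = swap (Orients.onEdges o⁺ {v} {u} a)

  fold-arc : ∀ {u v} → T (prepend {n} p dir u v) → T (dir (fold u) (fold v))
  fold-arc {u} {v} t = go p near {u} {v} (Orients.onEdges o⁺ t) t
    where
    go : ∀ p → Near {n} p dir → ∀ {u v} → Edge± (3 + n) u v → T (prepend {n} p dir u v) → T (dir (fold u) (fold v))
    -- The images of the five new edges are `a`, `b`, `c`, `f` and `g`; since adjacent squares turn
    -- oppositely, the directions agree.
    go true  (a , b , c , d , e , f , g) (inj₁ v₀) _ = b
    go true  (a , b , c , d , e , f , g) (inj₂ v₁) _ = g
    go true  (a , b , c , d , e , f , g) (inj₂ h₀) _ = a
    go true  (a , b , c , d , e , f , g) (inj₁ h₁) _ = c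
    go true  (a , b , c , d , e , f , g) (inj₂ h₂) _ = f
    go false (a , b , c , d , e , f , g) (inj₂ v₀) _ = b
    go false (a , b , c , d , e , f , g) (inj₁ v₁) _ = g
    go false (a , b , c , d , e , f , g) (inj₁ h₀) _ = a
    go false (a , b , c , d , e , f , g) (inj₂ h₁) _ = c
    go false (a , b , c , d , e , f , g) (inj₁ h₂) _ = f
    go p _ (inj₁ (shift e)) t = t
    go p _ (inj₂ (shift e)) t = t

  fold-walk : ∀ {u v m} → New.Walk u v m → Old.Walk (fold u) (fold v) m
  fold-walk New.nil        = nil
  fold-walk (New.cons {u} {_} {w} a p) = cons (fold-arc {u} {w} a) (fold-walk p)

  lift-walk : ∀ {u v m} → Old.Walk u v m → New.Walk (old u) (old v) m
  lift-walk nil        = New.nil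
  lift-walk (cons a w) = New.cons a (lift-walk w)

  -- Folding the new column onto the second old one shows that the old grid is isometric in the new one.
  between-fold : ∀ {u v w} → New.Between (old u) (old v) w → Old.Between u v (fold w)
  between-fold (a , b , p , q , short) = a , b , fold-walk p , fold-walk q , short ∘ lift-walk

  between-lift : ∀ {u v w} → Old.Between u v w → New.Between (old u) (old v) (old w)
  between-lift (a , b , p , q , short) = a , b , lift-walk p , lift-walk q , short ∘ fold-walk

  closed-restrict : ∀ {x y z R} → New.Closed (x ∷ y ∷ z ∷ R) → Old.Closed R
  closed-restrict cl u∈ v∈ b with cl (there (there (there u∈))) (there (there (there v∈))) (between-lift b)
  ... | there (there (there w∈)) = w∈

  old∈ : ∀ {x y z} {R : Subset ((2 + n) * 3)} {u} → _∈_ {(3 + n) * 3} (old u) (x ∷ y ∷ z ∷ R) → u ∈ R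
  old∈ (there (there (there u∈))) = u∈

  -- The first old column generates the new one through the two squares between them.
  full-prepend : ∀ {x y z R} → New.Closed (x ∷ y ∷ z ∷ R) → Full R → Full (x ∷ y ∷ z ∷ R)
  full-prepend cl full = λ where
      0F      → proj₁ top
      1F      → proj₂ top
      2F      → proj₁ bottom
      (old u) → there (there (there (full u)))
    where
    top    = top-outward cl (not p) near⁺ (there (there (there (full 0F)))) (there (there (there (full 1F))))
    bottom = bottom-outward cl (not p) near⁺ (there (there (there (full 2F)))) (there (there (there (full 1F))))

  strongly⁺ : New.Strongly
  strongly⁺ u v =
    let _ , w = to (not p) near⁺ u ; _ , w′ = from (not p) near⁺ v in _ , w New.++ʷ w′
    where
    old-walk : ∀ u v → ∃ (New.Walk (old u) (old v))
    old-walk u v = _ , lift-walk (proj₂ (st u v))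
    to : ∀ q → Near {suc n} q (prepend {n} p dir) → ∀ u → ∃ (New.Walk u 4F)
    to q near 0F      = proj₁ (hub q near 0F)
    to q near 1F      = proj₁ (hub q near 1F)
    to q near 2F      = proj₁ (hub q near 2F)
    to _ _    (old u) = old-walk u 1F
    from : ∀ q → Near {suc n} q (prepend {n} p dir) → ∀ u → ∃ (New.Walk 4F u)
    from q near 0F      = proj₂ (hub q near 0F)
    from q near 1F      = proj₂ (hub q near 1F)
    from q near 2F      = proj₂ (hub q near 2F)
    from _ _    (old u) = old-walk 1F u

-- Growing the largest closed set and padding beside it

First : Subset ((2 + n) * 3) → Set
First S = 0F ∈ S × 1F ∈ S × 2F ∈ S

-- The largest closed set contains the first column and absorbs every column prepended to it.
record Growing n r : Set where
  field
    {dir} : Digraph ((2 + n) * 3)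
    seed  : Seed (2 + n) dir r
    p     : Bool
    near  : Near {n} p dir
    first : First {n} (Seed.S seed)

grow-left : Growing n r → Growing (suc n) (3 + r)
grow-left {n} {r} g = record
  { seed = record
    { orients  = o⁺
    ; strongly = strongly⁺
    ; S        = S⁺
    ; closed   = closed⁺
    ; proper   = λ { eq → proper (tail≡ eq) }
    ; nonempty = 0F , here
    ; size     = cong (3 +_) size
    ; largest  = largest⁺
    }
  ; p     = not p
  ; near  = near⁺
  ; first = here , there here , there (there here)
  }
  where
  open Growing g
  open Seed seed using (S; closed; proper; size; largest; strongly; orients)
  open Extension {n} {p} orients near strongly

  S⁺ : Subset ((3 + n) * 3)
  S⁺ = true ∷ true ∷ true ∷ S

  tail≡ : ∀ {k} {R : Subset k} → _≡_ {A = Subset (3 + k)} (true ∷ true ∷ true ∷ R) ⊤ → R ≡ ⊤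
  tail≡ refl = refl

  -- A vertex of the new column has neighbours only there and in the first old column, all of which
  -- belong to `S⁺`.
  old-boundary : ∀ {f} → New.Boundary S⁺ f → ∃ λ f′ → f ≡ old f′ × f′ ∈ S
  old-boundary {old f} (f∈ , _) = f , refl , old∈ f∈
  old-boundary {0F} (_ , 0F , o∉ , _) = contradiction here o∉
  old-boundary {0F} (_ , 1F , o∉ , _) = contradiction (there here) o∉
  old-boundary {0F} (_ , 2F , o∉ , _) = contradiction (there (there here)) o∉
  old-boundary {1F} (_ , 0F , o∉ , _) = contradiction here o∉
  old-boundary {1F} (_ , 1F , o∉ , _) = contradiction (there here) o∉
  old-boundary {1F} (_ , 2F , o∉ , _) = contradiction (there (there here)) o∉
  old-boundary {2F} (_ , 0F , o∉ , _) = contradiction here o∉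
  old-boundary {2F} (_ , 1F , o∉ , _) = contradiction (there here) o∉
  old-boundary {2F} (_ , 2F , o∉ , _) = contradiction (there (there here)) o∉
  old-boundary {0F} (_ , old o , o∉ , a) with adjacent 0F (old o) a
  ... | inj₁ h₀ = contradiction (there (there (there (proj₁ first)))) o∉
  old-boundary {1F} (_ , old o , o∉ , a) with adjacent 1F (old o) a
  ... | inj₁ h₁ = contradiction (there (there (there (proj₁ (proj₂ first))))) o∉
  old-boundary {2F} (_ , old o , o∉ , a) with adjacent 2F (old o) a
  ... | inj₁ h₂ = contradiction (there (there (there (proj₂ (proj₂ first))))) o∉

  closed⁺ : New.Closed S⁺
  closed⁺ {w = w} u∈ v∈ b with w ∈? S⁺
  ... | yes w∈ = w∈
  ... | no w∉ with New.excursion u∈ v∈ w∉ b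
  ...   | f , g , bf , bg , b′ with old-boundary bf | old-boundary bg
  -- Folded, the excursion is a geodesic between members of `S`. The vertex `w` is outside the new
  -- column, so folding leaves it in place.
  ...     | f′ , refl , f∈ | g′ , refl , g∈ = retract w∉ (closed f∈ g∈ (between-fold b′))
    where
    retract : ∀ {w} → w ∉ S⁺ → fold w ∈ S → w ∈ S⁺
    retract {0F} _ _ = here
    retract {1F} _ _ = there here
    retract {2F} _ _ = there (there here)
    retract {old w} _ w∈ = there (there (there w∈))

  -- The old part of `R` is proper, since otherwise it would generate the new column, and the new
  -- column adds at most three members.
  largest⁺ : ∀ R → New.Closed R → R ≢ ⊤ → ∣ R ∣ ≤ 3 + r
  largest⁺ (x ∷ y ∷ z ∷ R) cl R≢⊤ =
    ℕ.≤-trans (ℕ.≤-reflexive (size-++ (x ∷ y ∷ z ∷ []) R)) (ℕ.+-mono-≤ (∣p∣≤n (x ∷ y ∷ z ∷ []))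
      (largest R (closed-restrict cl) λ { refl → R≢⊤ (full⇒⊤ (full-prepend cl λ _ → ∈⊤)) }))

-- An edge of the first column generates everything, so prepended columns enlarge no proper closed set.
record Sparse n r : Set where
  field
    {dir}   : Digraph ((2 + n) * 3)
    seed    : Seed (2 + n) dir r
    p       : Bool
    near    : Near {n} p dir
    avoids  : 0F ∉ Seed.S seed × 1F ∉ Seed.S seed × 2F ∉ Seed.S seed
    forcing : ∀ {R} → Seed.Closed seed R → 1F ∈ R → 0F ∈ R ⊎ 2F ∈ R → Full R

pad : Sparse n r → Sparse (suc n) r
pad {n} {r} g = record
  { seed = record
    { orients  = o⁺
    ; strongly = strongly⁺
    ; S        = S⁺
    ; closed   = closed⁺
    ; proper   = λ ()
    ; nonempty = let x , x∈ = nonempty in old x , there (there (there x∈))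
    ; size     = size
    ; largest  = largest⁺
    }
  ; p       = not p
  ; near    = near⁺
  ; avoids  = (λ ()) , (λ { (there ()) }) , λ { (there (there ())) }
  ; forcing = forcing⁺
  }
  where
  open Sparse g
  open Seed seed using (S; closed; proper; size; largest; strongly; orients; nonempty)
  open Extension {n} {p} orients near strongly
  open SquareRules o⁺

  S⁺ : Subset ((3 + n) * 3)
  S⁺ = false ∷ false ∷ false ∷ S

  -- Membership passes inward to the first old column, where the old `forcing` fills the old grid;
  -- this in turn fills the new column.
  forcing⁺ : ∀ {R} → New.Closed R → 1F ∈ R → 0F ∈ R ⊎ 2F ∈ R → Full R
  forcing⁺ {_ ∷ _ ∷ _ ∷ R} cl y∈ (inj₁ x∈) =
    let a , b = top-inward cl (not p) near⁺ x∈ y∈ in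
    full-prepend cl (forcing (closed-restrict cl) (old∈ b) (inj₁ (old∈ a)))
  forcing⁺ {_ ∷ _ ∷ _ ∷ R} cl y∈ (inj₂ z∈) =
    let a , b = bottom-inward cl (not p) near⁺ z∈ y∈ in
    full-prepend cl (forcing (closed-restrict cl) (old∈ b) (inj₂ (old∈ a)))

  Olds : Subset ((3 + n) * 3)
  Olds = false ∷ false ∷ false ∷ ⊤

  old-boundary : ∀ {f} → New.Boundary Olds f → ∃ λ f′ → f ≡ old f′ × f′ ∉ S
  old-boundary {1F} (there () , _)
  old-boundary {2F} (there (there ()) , _)
  old-boundary {old f} (_ , old o , o∉ , _) = contradiction (there (there (there ∈⊤))) o∉
  old-boundary {old f} (_ , 0F , _ , a) with adjacent (old f) 0F a
  ... | inj₂ h₀ = f , refl , proj₁ avoids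
  old-boundary {old f} (_ , 1F , _ , a) with adjacent (old f) 1F a
  ... | inj₂ h₁ = f , refl , proj₁ (proj₂ avoids)
  old-boundary {old f} (_ , 2F , _ , a) with adjacent (old f) 2F a
  ... | inj₂ h₂ = f , refl , proj₂ (proj₂ avoids)

  -- A geodesic between members of `S` that visits the new column passes through the first old
  -- column. By closedness that vertex would lie in `S`, which avoids this column.
  stays : ∀ {u v w} → u ∈ S → v ∈ S → w ∉ Olds → ¬ New.Between (old u) (old v) w
  stays u∈ v∈ w∉ (a , b , p , q , short) with New.leave (there (there (there ∈⊤))) w∉ p
  ... | f , bf , i , j , p₁ , p₂ , refl with old-boundary bf
  ...   | f′ , refl , f∉ = f∉ (closed u∈ v∈ (between-fold
            (i , j + b , p₁ , p₂ New.++ʷ q , λ {m} w → subst (_≤ m) (ℕ.+-assoc i j b) (short w))))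

  closed⁺ : New.Closed S⁺
  closed⁺ {w = old w} (there (there (there u∈))) (there (there (there v∈))) b =
    there (there (there (closed u∈ v∈ (between-fold b))))
  closed⁺ {w = 0F} (there (there (there u∈))) (there (there (there v∈))) b =
    contradiction b (stays u∈ v∈ λ ())
  closed⁺ {w = 1F} (there (there (there u∈))) (there (there (there v∈))) b =
    contradiction b (stays u∈ v∈ λ { (there ()) })
  closed⁺ {w = 2F} (there (there (there u∈))) (there (there (there v∈))) b =
    contradiction b (stays u∈ v∈ λ { (there (there ())) })

  positive : 1 ≤ r
  positive = subst (1 ≤_) size (ℕ.≤-trans (s≤s z≤n) (x∈p⇒∣p-x∣<∣p∣ (proj₂ nonempty)))

  module _ {R} (cl : New.Closed R) where

    around : ∀ {u v} → u ∈ R → v ∈ R → u ≢ v → ∃₂ λ x y → x ∈ R × y ∈ R ×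
             T (prepend {n} p dir x v) × T (prepend {n} p dir v y)
    around u∈ v∈ u≢v =
      let x , x∈ , xv = New.inNeighbour strongly⁺ cl u∈ v∈ u≢v
          y , y∈ , vy = New.outNeighbour strongly⁺ cl v∈ u∈ (u≢v ∘ sym)
      in x , y , x∈ , y∈ , xv , vy

    -- A corner has only two neighbours, and its in-neighbour and out-neighbour in `R` differ, so
    -- one of them is `1F`.
    middle∈ : ∀ {u v} → u ∈ R → v ∈ R → u ≢ v → v ≡ 0F ⊎ v ≡ 2F → 1F ∈ R
    middle∈ u∈ v∈ u≢v v≡ with around u∈ v∈ u≢v
    ... | x , y , x∈ , y∈ , xv , vy = go v≡ (adjacent x _ (inj₁ xv)) (adjacent _ y (inj₁ vy)) xv vy
      where
      go : ∀ {v} → v ≡ 0F ⊎ v ≡ 2F → Edge± (3 + n) x v → Edge± (3 + n) v y →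
           T (prepend {n} p dir x v) → T (prepend {n} p dir v y) → 1F ∈ R
      go (inj₁ refl) (inj₂ v₀) _ _ _ = x∈
      go (inj₁ refl) _ (inj₁ v₀) _ _ = y∈
      go (inj₁ refl) (inj₂ h₀) (inj₁ h₀) xv vy = contradiction vy (New.arc-asym {3F} {0F} xv)
      go (inj₂ refl) (inj₁ v₁) _ _ _ = x∈
      go (inj₂ refl) _ (inj₂ v₁) _ _ = y∈
      go (inj₂ refl) (inj₂ h₂) (inj₁ h₂) xv vy = contradiction vy (New.arc-asym {5F} {2F} xv)

    -- The vertical arcs at `1F` both enter it or both leave it, so one of its in-neighbour and
    -- out-neighbour in `R` is `4F`.
    across : ∀ {u} → u ∈ R → 1F ∈ R → u ≢ 1F → 4F ∈ R
    across u∈ v∈ u≢v with around u∈ v∈ u≢v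
    ... | x , y , x∈ , y∈ , xv , vy = go p (adjacent x _ (inj₁ xv)) (adjacent _ y (inj₁ vy)) xv vy
      where
      go : ∀ p → Edge± (3 + n) x 1F → Edge± (3 + n) 1F y →
           T (prepend {n} p dir x 1F) → T (prepend {n} p dir 1F y) → 4F ∈ R
      go _ (inj₂ h₁) _ _ _ = x∈
      go _ _ (inj₁ h₁) _ _ = y∈
      go true  (inj₁ v₀) (inj₂ v₀) _ ()
      go true  (inj₁ v₀) (inj₁ v₁) _ ()
      go true  (inj₂ v₁) (inj₂ v₀) _ ()
      go true  (inj₂ v₁) (inj₁ v₁) _ ()
      go false (inj₁ v₀) _ () _
      go false (inj₂ v₁) _ () _

    -- Such a set contains `1F` and then also a corner of the new column, so `forcing⁺` applies.
    touching : ∀ {u v} → u ∈ R → v ∈ R → u ≢ v → v ≡ 0F ⊎ v ≡ 1F ⊎ v ≡ 2F → Full R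
    touching {u} {v} u∈ v∈ u≢v v≡ = fill v≡
      where
      fill-middle : ∀ {u} → u ∈ R → 1F ∈ R → u ≢ 1F → Full R
      fill-middle u∈ y∈ u≢y = forcing⁺ cl y∈ (inj₁ (proj₁ (middle cl (not p) near⁺ y∈ (across u∈ y∈ u≢y))))
      fill : v ≡ 0F ⊎ v ≡ 1F ⊎ v ≡ 2F → Full R
      fill (inj₁ refl)        = forcing⁺ cl (middle∈ u∈ v∈ u≢v (inj₁ refl)) (inj₁ v∈)
      fill (inj₂ (inj₁ refl)) = fill-middle u∈ v∈ u≢v
      fill (inj₂ (inj₂ refl)) = forcing⁺ cl (middle∈ u∈ v∈ u≢v (inj₂ refl)) (inj₂ v∈)

    touching-size : ∀ {v} → v ∈ R → R ≢ ⊤ → v ≡ 0F ⊎ v ≡ 1F ⊎ v ≡ 2F → ∣ R ∣ ≤ r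
    touching-size v∈ R≢⊤ v≡ with ∣ R ∣ ℕ.≤? 1
    ... | yes small = ℕ.≤-trans small positive
    ... | no ¬small =
      let u , u∈ , u≢v = another v∈ (ℕ.≰⇒> ¬small) in
      contradiction (full⇒⊤ (touching u∈ v∈ u≢v v≡)) R≢⊤

  largest⁺ : ∀ R → New.Closed R → R ≢ ⊤ → ∣ R ∣ ≤ r
  largest⁺ (true ∷ _ ∷ _ ∷ R) cl R≢⊤ = touching-size cl here R≢⊤ (inj₁ refl)
  largest⁺ (false ∷ true ∷ _ ∷ R) cl R≢⊤ = touching-size cl (there here) R≢⊤ (inj₂ (inj₁ refl))
  largest⁺ (false ∷ false ∷ true ∷ R) cl R≢⊤ = touching-size cl (there (there here)) R≢⊤ (inj₂ (inj₂ refl))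
  largest⁺ (false ∷ false ∷ false ∷ R) cl _ = largest R (closed-restrict cl)
    λ { refl → contradiction (full-prepend cl (λ _ → ∈⊤) 0F) λ () }

-- Rotation by 180°

mirror : Subset N → Subset N
mirror S = tabulate (lookup S ∘ opposite)

∈-mirror⁺ : ∀ (S : Subset N) {u} → opposite u ∈ S → u ∈ mirror S
∈-mirror⁺ S {u} u∈ = T⇒∈ {S = mirror S} (subst T (sym (lookup∘tabulate (lookup S ∘ opposite) u)) (∈⇒T u∈))

∈-mirror⁻ : ∀ (S : Subset N) {u} → u ∈ mirror S → opposite u ∈ S
∈-mirror⁻ S {u} u∈ = T⇒∈ {S = S} (subst T (lookup∘tabulate (lookup S ∘ opposite) u) (∈⇒T u∈))

mirror-mirror : ∀ (S : Subset N) → mirror (mirror S) ≡ S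
mirror-mirror S = trans (tabulate-cong λ u → trans (lookup∘tabulate (lookup S ∘ opposite) (opposite u))
                      (cong (lookup S) (opposite-involutive u))) (tabulate∘lookup S)

size-sum : ∀ (S : Subset N) → ∣ S ∣ ≡ sum λ u → if lookup S u then 1 else 0
size-sum []          = refl
size-sum (true ∷ S)  = cong suc (size-sum S)
size-sum (false ∷ S) = size-sum S

-- The cardinality is written as a sum, which the permutation `opposite` preserves.
size-mirror : ∀ (S : Subset N) → ∣ mirror S ∣ ≡ ∣ S ∣
size-mirror S = begin
  ∣ mirror S ∣                                         ≡⟨ size-sum (mirror S) ⟩
  sum (λ u → if lookup (mirror S) u then 1 else 0)     ≡⟨ sum-cong-≗ (λ u → cong (λ b → if b then 1 else 0) (lookup∘tabulate (lookup S ∘ opposite) u)) ⟩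
  sum (λ u → if lookup S (opposite u) then 1 else 0) ≡⟨ sum-permute (λ u → if lookup S u then 1 else 0) Permutation.reverse ⟨
  sum (λ u → if lookup S u then 1 else 0)            ≡⟨ size-sum S ⟨
  ∣ S ∣                                              ∎
  where open ≡-Reasoning

rotate : Digraph N → Digraph N
rotate dir u v = dir (opposite u) (opposite v)

orients-rotate : ∀ {dir} → Orients n dir → Orients n (rotate dir)
orients-rotate {n} {dir} o = record
  { onEdges = λ t → subst₂ (Edge± n) (opposite-involutive _) (opposite-involutive _)
                (swap (Sum.map edge-opposite edge-opposite (Orients.onEdges o t)))
  ; opposed = λ e → trans (sym (not-involutive _)) (cong not (sym (Orients.opposed o (edge-opposite e))))
  }

module Rotation {n} {dir : Digraph (n * 3)} (o : Orients n dir) where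
  module D = GridWalks (Orients.orientation o)
  module R = GridWalks (Orients.orientation (orients-rotate o))

  walk-to : ∀ {u v m} → R.Walk u v m → D.Walk (opposite u) (opposite v) m
  walk-to R.nil        = D.nil
  walk-to (R.cons a p) = D.cons a (walk-to p)

  walk-from : ∀ {u v m} → D.Walk u v m → R.Walk (opposite u) (opposite v) m
  walk-from D.nil        = R.nil
  walk-from (D.cons a p) =
    R.cons (subst₂ (λ u v → T (dir u v)) (sym (opposite-involutive _)) (sym (opposite-involutive _)) a) (walk-from p)

  walk-back : ∀ {u v m} → D.Walk (opposite u) (opposite v) m → R.Walk u v m
  walk-back p = subst₂ (λ u v → R.Walk u v _) (opposite-involutive _) (opposite-involutive _) (walk-from p)

  between-to : ∀ {u v w} → R.Between u v w → D.Between (opposite u) (opposite v) (opposite w)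
  between-to (a , b , p , q , short) = a , b , walk-to p , walk-to q , short ∘ walk-back

  between-from : ∀ {u v w} → D.Between u v w → R.Between (opposite u) (opposite v) (opposite w)
  between-from {u} {v} (a , b , p , q , short) = a , b , walk-from p , walk-from q , λ w →
    short (subst₂ (λ u v → D.Walk u v _) (opposite-involutive u) (opposite-involutive v) (walk-to w))

  closed-to : ∀ {S} → D.Closed S → R.Closed (mirror S)
  closed-to {S} cl u∈ v∈ b = ∈-mirror⁺ S (cl (∈-mirror⁻ S u∈) (∈-mirror⁻ S v∈) (between-to b))

  closed-from : ∀ {S} → R.Closed S → D.Closed (mirror S)
  closed-from {S} cl u∈ v∈ b = ∈-mirror⁺ S (cl (∈-mirror⁻ S u∈) (∈-mirror⁻ S v∈) (between-from b))

mirror-⊤ : mirror (⊤ {N}) ≡ ⊤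
mirror-⊤ = full⇒⊤ λ x → ∈-mirror⁺ ⊤ ∈⊤

seed-rotate : ∀ {dir} → Seed n dir r → Seed n (rotate dir) r
seed-rotate {r = r} s = record
  { orients  = orients-rotate orients
  ; strongly = λ u v → let _ , p = strongly (opposite u) (opposite v) in _ , walk-back p
  ; S        = mirror S
  ; closed   = closed-to closed
  ; proper   = λ eq → proper (trans (sym (mirror-mirror S)) (trans (cong mirror eq) mirror-⊤))
  ; nonempty = let x , x∈ = nonempty in opposite x , ∈-mirror⁺ S (subst (_∈ S) (sym (opposite-involutive x)) x∈)
  ; size     = trans (size-mirror S) size
  ; largest  = λ R cl R≢⊤ → subst (_≤ r) (size-mirror R) (largest (mirror R) (closed-from cl)
                 λ eq → R≢⊤ (trans (sym (mirror-mirror R)) (trans (cong mirror eq) mirror-⊤)))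
  }
  where
  open Seed s using (orients; S; closed; proper; size; largest; strongly; nonempty)
  open Rotation orients

-- A sparse orientation whose largest closed set lies at the far end.
record Padded n r : Set where
  field
    sparse : Sparse n r
  open Sparse sparse
  open Seed seed using (S)
  field
    q      : Bool
    far    : Squares {n * 3} q opposite dir
    last   : opposite {6 + n * 3} 0F ∈ S × opposite {6 + n * 3} 1F ∈ S × opposite {6 + n * 3} 2F ∈ S

pad-again : Padded n r → Padded (suc n) r
pad-again {n} p = record
  { sparse = pad sparse
  ; q      = q
  ; far    = far⁺ q far
  ; last   = let a , b , c = last in there (there (there a)) , there (there (there b)) , there (there (there c))
  }
  where
  open Padded p
  far⁺ : ∀ q → Squares {n * 3} q opposite (Sparse.dir sparse) →
         Squares {suc n * 3} q opposite (Sparse.dir (pad sparse))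
  -- Prepending keeps the arcs among old vertices, and the last vertices only gain three successors.
  -- Once `q` is known, both sides compute to the same arcs.
  far⁺ true  s = s
  far⁺ false s = s

-- The rotation carries the largest closed set from the far end to the first column, where it can
-- grow.
turn : Padded n r → Growing n r
turn {n} p = record
  { seed  = seed-rotate seed
  ; p     = q
  ; near  = near q far
  ; first = let a , b , c = last in ∈-mirror⁺ S a , ∈-mirror⁺ S b , ∈-mirror⁺ S c
  }
  where
  open Padded p
  open Sparse sparse using (seed; dir)
  open Seed seed using (S)
  near : ∀ q → Squares {n * 3} q opposite dir → Near {n} q (rotate dir)
  near true  s = s
  near false s = s

-- The base orientations

pattern ● = true
pattern ○ = false

growing : ∀ p (as : Vec Arrows (2 + n)) A B → T (check (grid as) A B []) → Near {n} p (grid as) →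
          First {n} A → A ≢ ⊤ → ∣ A ∣ ≡ r → 1 ≤ r → ∣ B ∣ ≤ r → Growing n r
growing p as A B c near first A≢⊤ A≡r 1≤r B≤r = record
  { seed = checked-seed as A B [] c A≢⊤ A≡r 1≤r B≤r ; p = p ; near = near ; first = first }

-- The required pairs are the two vertical edges of the first column; they yield `forcing`.
sparse : ∀ p (as : Vec Arrows (2 + n)) A B → T (check (grid as) A B ((0F , 1F) ∷ (2F , 1F) ∷ [])) → Near {n} p (grid as) →
         A ≢ ⊤ → ∣ A ∣ ≡ r → 1 ≤ r → ∣ B ∣ ≤ r → 0F ∉ A × 1F ∉ A × 2F ∉ A → Sparse n r
sparse p as A B c near A≢⊤ A≡r 1≤r B≤r avoids = record
  { seed    = checked-seed as A B ((0F , 1F) ∷ (2F , 1F) ∷ []) c A≢⊤ A≡r 1≤r B≤r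
  ; p       = p
  ; near    = near
  ; avoids  = avoids
  ; forcing = λ { cl y∈ (inj₁ x∈) → top (checked-forcing as A B ((0F , 1F) ∷ (2F , 1F) ∷ []) c cl) x∈ y∈
                ; cl y∈ (inj₂ z∈) → bottom (checked-forcing as A B ((0F , 1F) ∷ (2F , 1F) ∷ []) c cl) z∈ y∈ }
  }
  where
  top : ∀ {P : _ → Set} {e f} → All P (e ∷ f ∷ []) → P e
  top (p ∷ _) = p
  bottom : ∀ {P : _ → Set} {e f} → All P (e ∷ f ∷ []) → P f
  bottom (_ ∷ p ∷ _) = p

padded : ∀ q (s : Sparse n r) → Squares {n * 3} q opposite (Sparse.dir s) →
         (let S = Seed.S (Sparse.seed s) in
          T (lookup S (opposite {6 + n * 3} 0F)) × T (lookup S (opposite {6 + n * 3} 1F)) × T (lookup S (opposite {6 + n * 3} 2F))) → Padded n r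
padded q s far (a , b , c) = record { sparse = s ; q = q ; far = far ; last = T⇒∈ a , T⇒∈ b , T⇒∈ c }

-- In these names the first index counts columns and the second is the convexity number. The first
-- set listed, three cells per column, is the largest closed set, and `tt` is the evaluated check.
growing₃,₆ : Growing 1 6
growing₃,₆ = growing true
    ( (↑ ∷ ↓ ∷ ▸ ∷ ◂ ∷ ▸ ∷ [])
    ∷ (↓ ∷ ↑ ∷ ▸ ∷ ◂ ∷ ▸ ∷ [])
    ∷ (↓ ∷ ↑ ∷ ▸ ∷ ▸ ∷ ▸ ∷ [])
    ∷ [] )
    (● ∷ ● ∷ ● ∷ ● ∷ ● ∷ ● ∷ ○ ∷ ○ ∷ ○ ∷ [])
    ⊥
    tt _ (here , there here , there (there here)) (λ ()) refl (s≤s z≤n) (ℕ.≤ᵇ⇒≤ _ _ _)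

growing₄,₆ : Growing 2 6
growing₄,₆ = growing true
    ( (↑ ∷ ↓ ∷ ▸ ∷ ◂ ∷ ▸ ∷ [])
    ∷ (↓ ∷ ↑ ∷ ◂ ∷ ◂ ∷ ▸ ∷ [])
    ∷ (↓ ∷ ↑ ∷ ◂ ∷ ◂ ∷ ▸ ∷ [])
    ∷ (↑ ∷ ↑ ∷ ▸ ∷ ▸ ∷ ▸ ∷ [])
    ∷ [] )
    (● ∷ ● ∷ ● ∷ ● ∷ ● ∷ ● ∷ ○ ∷ ○ ∷ ○ ∷ ○ ∷ ○ ∷ ○ ∷ [])
    ⊥
    tt _ (here , there here , there (there here)) (λ ()) refl (s≤s z≤n) (ℕ.≤ᵇ⇒≤ _ _ _)

padded₅,₆ : Padded 3 6
padded₅,₆ = padded true (sparse true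
      ( (↑ ∷ ↓ ∷ ▸ ∷ ◂ ∷ ▸ ∷ [])
      ∷ (↓ ∷ ↑ ∷ ◂ ∷ ▸ ∷ ◂ ∷ [])
      ∷ (↑ ∷ ↑ ∷ ◂ ∷ ▸ ∷ ◂ ∷ [])
      ∷ (↓ ∷ ↑ ∷ ◂ ∷ ▸ ∷ ◂ ∷ [])
      ∷ (↑ ∷ ↓ ∷ ▸ ∷ ▸ ∷ ▸ ∷ [])
      ∷ [] )
      (○ ∷ ○ ∷ ○ ∷ ○ ∷ ○ ∷ ○ ∷ ○ ∷ ○ ∷ ○ ∷ ● ∷ ● ∷ ● ∷ ● ∷ ● ∷ ● ∷ [])
      ⊥
      tt _ (λ ()) refl (s≤s z≤n) (ℕ.≤ᵇ⇒≤ _ _ _)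
      ((λ ()) , (λ { (there ()) }) , λ { (there (there ())) }))
    _ _

growing₄,₈ : Growing 2 8
growing₄,₈ = growing false
    ( (↓ ∷ ↑ ∷ ◂ ∷ ▸ ∷ ◂ ∷ [])
    ∷ (↑ ∷ ↓ ∷ ◂ ∷ ◂ ∷ ▸ ∷ [])
    ∷ (↓ ∷ ↑ ∷ ◂ ∷ ◂ ∷ ▸ ∷ [])
    ∷ (↑ ∷ ↑ ∷ ▸ ∷ ▸ ∷ ▸ ∷ [])
    ∷ [] )
    (● ∷ ● ∷ ● ∷ ● ∷ ● ∷ ● ∷ ○ ∷ ● ∷ ● ∷ ○ ∷ ○ ∷ ○ ∷ [])
    ⊥
    tt _ (here , there here , there (there here)) (λ ()) refl (s≤s z≤n) (ℕ.≤ᵇ⇒≤ _ _ _)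

growing₅,₈ : Growing 3 8
growing₅,₈ = growing true
    ( (↑ ∷ ↓ ∷ ▸ ∷ ◂ ∷ ▸ ∷ [])
    ∷ (↓ ∷ ↑ ∷ ▸ ∷ ▸ ∷ ◂ ∷ [])
    ∷ (↑ ∷ ↓ ∷ ▸ ∷ ▸ ∷ ◂ ∷ [])
    ∷ (↓ ∷ ↑ ∷ ◂ ∷ ▸ ∷ ◂ ∷ [])
    ∷ (↑ ∷ ↓ ∷ ▸ ∷ ▸ ∷ ▸ ∷ [])
    ∷ [] )
    (● ∷ ● ∷ ● ∷ ● ∷ ● ∷ ● ∷ ○ ∷ ● ∷ ● ∷ ○ ∷ ○ ∷ ○ ∷ ○ ∷ ○ ∷ ○ ∷ [])
    -- A proper closed set that is not contained in the set above lies within these six vertices or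
    -- is a single vertex.
    (○ ∷ ○ ∷ ○ ∷ ○ ∷ ○ ∷ ○ ∷ ○ ∷ ○ ∷ ○ ∷ ● ∷ ● ∷ ● ∷ ● ∷ ● ∷ ● ∷ [])
    tt _ (here , there here , there (there here)) (λ ()) refl (s≤s z≤n) (ℕ.≤ᵇ⇒≤ _ _ _)

padded₆,₈ : Padded 4 8
padded₆,₈ = padded true (sparse false
      ( (↓ ∷ ↑ ∷ ◂ ∷ ▸ ∷ ◂ ∷ [])
      ∷ (↑ ∷ ↓ ∷ ▸ ∷ ◂ ∷ ▸ ∷ [])
      ∷ (↑ ∷ ↑ ∷ ▸ ∷ ▸ ∷ ◂ ∷ [])
      ∷ (↑ ∷ ↓ ∷ ▸ ∷ ◂ ∷ ◂ ∷ [])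
      ∷ (↓ ∷ ↑ ∷ ◂ ∷ ▸ ∷ ◂ ∷ [])
      ∷ (↑ ∷ ↓ ∷ ▸ ∷ ▸ ∷ ▸ ∷ [])
      ∷ [] )
      (○ ∷ ○ ∷ ○ ∷ ○ ∷ ○ ∷ ○ ∷ ○ ∷ ○ ∷ ○ ∷ ● ∷ ● ∷ ○ ∷ ● ∷ ● ∷ ● ∷ ● ∷ ● ∷ ● ∷ [])
      ⊥
      tt _ (λ ()) refl (s≤s z≤n) (ℕ.≤ᵇ⇒≤ _ _ _)
      ((λ ()) , (λ { (there ()) }) , λ { (there (there ())) }))
    _ _

growing₅,₁₀ : Growing 3 10
growing₅,₁₀ = growing false
    ( (↓ ∷ ↑ ∷ ◂ ∷ ▸ ∷ ◂ ∷ [])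
    ∷ (↑ ∷ ↓ ∷ ◂ ∷ ◂ ∷ ▸ ∷ [])
    ∷ (↓ ∷ ↑ ∷ ◂ ∷ ◂ ∷ ▸ ∷ [])
    ∷ (↓ ∷ ↑ ∷ ◂ ∷ ◂ ∷ ▸ ∷ [])
    ∷ (↑ ∷ ↑ ∷ ▸ ∷ ▸ ∷ ▸ ∷ [])
    ∷ [] )
    (● ∷ ● ∷ ● ∷ ● ∷ ● ∷ ● ∷ ○ ∷ ● ∷ ● ∷ ○ ∷ ● ∷ ● ∷ ○ ∷ ○ ∷ ○ ∷ [])
    ⊥
    tt _ (here , there here , there (there here)) (λ ()) refl (s≤s z≤n) (ℕ.≤ᵇ⇒≤ _ _ _)

padded₆,₁₀ : Padded 4 10
padded₆,₁₀ = padded false (sparse true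
      ( (↑ ∷ ↓ ∷ ▸ ∷ ◂ ∷ ▸ ∷ [])
      ∷ (↓ ∷ ↑ ∷ ◂ ∷ ◂ ∷ ▸ ∷ [])
      ∷ (↑ ∷ ↑ ∷ ▸ ∷ ◂ ∷ ▸ ∷ [])
      ∷ (↓ ∷ ↑ ∷ ◂ ∷ ▸ ∷ ▸ ∷ [])
      ∷ (↑ ∷ ↓ ∷ ▸ ∷ ◂ ∷ ▸ ∷ [])
      ∷ (↓ ∷ ↑ ∷ ▸ ∷ ▸ ∷ ▸ ∷ [])
      ∷ [] )
      (○ ∷ ○ ∷ ○ ∷ ○ ∷ ○ ∷ ○ ∷ ● ∷ ● ∷ ○ ∷ ● ∷ ● ∷ ○ ∷ ● ∷ ● ∷ ● ∷ ● ∷ ● ∷ ● ∷ [])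
      ⊥
      tt _ (λ ()) refl (s≤s z≤n) (ℕ.≤ᵇ⇒≤ _ _ _)
      ((λ ()) , (λ { (there ()) }) , λ { (there (there ())) }))
    _ _

sparse₃,₁ : Sparse 1 1
sparse₃,₁ = sparse true
    ( (↑ ∷ ↓ ∷ ▸ ∷ ◂ ∷ ▸ ∷ [])
    ∷ (↓ ∷ ↑ ∷ ◂ ∷ ▸ ∷ ◂ ∷ [])
    ∷ (↑ ∷ ↓ ∷ ▸ ∷ ▸ ∷ ▸ ∷ [])
    ∷ [] )
    (○ ∷ ○ ∷ ○ ∷ ○ ∷ ○ ∷ ○ ∷ ○ ∷ ○ ∷ ● ∷ [])
    ⊥
    tt _ (λ ()) refl (s≤s z≤n) (ℕ.≤ᵇ⇒≤ _ _ _)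
    ((λ ()) , (λ { (there ()) }) , λ { (there (there ())) })

-- This serves three columns only; wider grids obtain 4 by padding `sparse₄,₄`.
seed₃,₄ : ∃ λ dir → Seed 3 dir 4
seed₃,₄ = _ , checked-seed
    ( (↓ ∷ ↓ ∷ ◂ ∷ ▸ ∷ ▸ ∷ [])
    ∷ (↑ ∷ ↓ ∷ ◂ ∷ ◂ ∷ ▸ ∷ [])
    ∷ (↑ ∷ ↑ ∷ ▸ ∷ ▸ ∷ ▸ ∷ [])
    ∷ [] )
    (○ ∷ ○ ∷ ○ ∷ ○ ∷ ● ∷ ● ∷ ○ ∷ ● ∷ ● ∷ [])
    (● ∷ ● ∷ ○ ∷ ● ∷ ● ∷ ○ ∷ ○ ∷ ○ ∷ ○ ∷ [])
    [] tt (λ ()) refl (s≤s z≤n) (ℕ.≤ᵇ⇒≤ _ _ _)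

sparse₄,₄ : Sparse 2 4
sparse₄,₄ = sparse true
    ( (↑ ∷ ↓ ∷ ▸ ∷ ◂ ∷ ▸ ∷ [])
    ∷ (↓ ∷ ↑ ∷ ▸ ∷ ◂ ∷ ◂ ∷ [])
    ∷ (↓ ∷ ↓ ∷ ◂ ∷ ◂ ∷ ▸ ∷ [])
    ∷ (↑ ∷ ↑ ∷ ▸ ∷ ▸ ∷ ▸ ∷ [])
    ∷ [] )
    (○ ∷ ○ ∷ ○ ∷ ○ ∷ ○ ∷ ○ ∷ ○ ∷ ● ∷ ● ∷ ○ ∷ ● ∷ ● ∷ [])
    ⊥
    tt _ (λ ()) refl (s≤s z≤n) (ℕ.≤ᵇ⇒≤ _ _ _)
    ((λ ()) , (λ { (there ()) }) , λ { (there (there ())) })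

-- Families for every number of columns

padded₆ : ∀ n → Padded (3 + n) 6
padded₆ zero    = padded₅,₆
padded₆ (suc n) = pad-again (padded₆ n)

padded₈ : ∀ n → Padded (4 + n) 8
padded₈ zero    = padded₆,₈
padded₈ (suc n) = pad-again (padded₈ n)

padded₁₀ : ∀ n → Padded (4 + n) 10
padded₁₀ zero    = padded₆,₁₀
padded₁₀ (suc n) = pad-again (padded₁₀ n)

-- From five columns on, the orientation is padded away from its largest closed set and then turned.
growing₆ : ∀ n → Growing (1 + n) 6
growing₆ zero          = growing₃,₆
growing₆ (suc zero)    = growing₄,₆
growing₆ (suc (suc n)) = turn (padded₆ n)

growing₈ : ∀ n → Growing (2 + n) 8
growing₈ zero          = growing₄,₈
growing₈ (suc zero)    = growing₅,₈
growing₈ (suc (suc n)) = turn (padded₈ n)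

growing₁₀ : ∀ n → Growing (3 + n) 10
growing₁₀ zero    = growing₅,₁₀
growing₁₀ (suc n) = turn (padded₁₀ n)

sparse₁ : ∀ n → Sparse (1 + n) 1
sparse₁ zero    = sparse₃,₁
sparse₁ (suc n) = pad (sparse₁ n)

sparse₄ : ∀ n → Sparse (2 + n) 4
sparse₄ zero    = sparse₄,₄
sparse₄ (suc n) = pad (sparse₄ n)

-- Removing a column lowers `s` by 3, down to the base values 6, 8 and 10. From 10 a further step
-- would lead to the excluded 7, so 10 has orientations of its own; from `s` at least 5 the step
-- avoids 1.
growing-from-6 : ∀ m s → s ≤ m * 3 → s ≢ 1 → Growing (1 + m) (6 + s)
growing-from-6 m 0 _ _ = growing₆ m
growing-from-6 m 1 _ s≢1 = contradiction refl s≢1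
growing-from-6 (suc m) 2 _ _ = growing₈ m
growing-from-6 (suc (suc m)) 4 _ _ = growing₁₀ m
-- With `m` equal to 1 the bound on `s` is 3.
growing-from-6 (suc zero) 4 (s≤s (s≤s (s≤s ()))) _
growing-from-6 (suc m) 3 _ _ = grow-left (growing-from-6 m 0 z≤n λ ())
growing-from-6 (suc m) (suc (suc (suc s@(suc (suc _))))) (s≤s (s≤s (s≤s s≤))) _ = grow-left (growing-from-6 m s s≤ λ ())

sufficient : ∀ m {r} → 1 ≤ r → r ≤ 6 + m * 3 → ¬ r List.∈ 2 ∷ 3 ∷ 5 ∷ 7 ∷ [] →
             StrongConvexitySpectrum (Grid (3 + m)) r
sufficient m {1} _ _ _ = seed⇒spectrum (Sparse.seed (sparse₁ m))
sufficient m {2} _ _ r∉ = contradiction (Any.here refl) r∉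
sufficient m {3} _ _ r∉ = contradiction (Any.there (Any.here refl)) r∉
sufficient zero {4} _ _ _ = seed⇒spectrum (proj₂ seed₃,₄)
sufficient (suc m) {4} _ _ _ = seed⇒spectrum (Sparse.seed (sparse₄ m))
sufficient m {5} _ _ r∉ = contradiction (Any.there (Any.there (Any.here refl))) r∉
sufficient m {suc (suc (suc (suc (suc (suc s)))))} _ (s≤s (s≤s (s≤s (s≤s (s≤s (s≤s s≤)))))) r∉ =
  seed⇒spectrum (Growing.seed (growing-from-6 m s s≤ λ { refl → r∉ (Any.there (Any.there (Any.there (Any.here refl)))) }))

theorem15 : (n : ℕ) → 3 ≤ n →
    StrongConvexitySpectrum (P n □ P 3) ≐
    ((λ r → 1 ≤ r × r ≤ 3 * n ∸ 3) ∖ (λ r → r List.∈ 2 ∷ 3 ∷ 5 ∷ 7 ∷ []))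
theorem15 (suc (suc (suc m))) (s≤s (s≤s (s≤s _))) =
  -- After commuting the product, `(3 + m) * 3 ∸ 3` computes to `6 + m * 3`.
  necessary m , λ {r} ((1≤r , r≤) , r∉) → sufficient m 1≤r (subst (r ≤_) (cong (_∸ 3) (ℕ.*-comm 3 (3 + m))) r≤) r∉
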